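{- Let $d\ge 3$ and let $\Box_d$ be the folded $d$-cube. Then $\Box_d$ has $z$-vector $z=d^{\,2^{d-2}(d-1)!}$, i.e. it has exactly $2^{d-2}(d-1)!$ zigzags (up to reversal), all of length $d$ and without self-intersections; and every zigzag has intersection vector $\mathrm{Int}=(0,1)^d$.
   Context: The folded cube $\Box_d$ is the $(d-1)$-dimensional complex obtained from the boundary complex of the $d$-cube $\gamma_d=[-1,1]^d$ by identifying opposite faces: its elements are a smallest element $0$, a greatest element $1$, and the pairs $\{F,-F\}$ of opposite proper nonempty faces of $\gamma_d$ (of dimension $\dim F$), where $\{F,-F\}\le\{G,-G\}$ iff $F\subset G$ or $-F\subset G$. Its flags are the images of flags of $\gamma_d$, i.e. maximal chains $(0,x_1,\dots,x_d,1)$ with $\dim x_i=i-1$. For $1\le i\le d$, $\sigma_i$ is the involution on flags replacing $x_i$ by the unique $x_i'\neq x_i$ with $x_{i-1}\le x_i'\le x_{i+1}$ (where $x_0=0$, $x_{d+1}=1$). Put $T=\sigma_d\sigma_{d-1}\cdots\sigma_1$ ($\sigma_1$ applied first). A zigzag is a circuit $Z=(f_1,\dots,f_l)$ of flags (an orbit of $T$, listed cyclically, up to cyclic shift) with $f_{j+1}=T(f_j)$, indices modulo $l$; $l$ is its length. For a flag $f=(0,x_1,\dots,x_d,1)$ there is a unique family $(x_{i,j})_{1\le i\le d,1\le j\le d+1-i}$ with $x_{i,1}=x_i$, $\dim x_{i,j}=i-1$, $x_{i,j}\le x_{i+1,j}$, $x_{i,j}\le x_{i+1,j-1}$, and $x_{i,j}\ne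 x_{i,j-1}$ whenever the indices make sense; the reverse of $f$ is the flag $f^t=(0,x_{1,d},x_{2,d-1},\dots,x_{d,1},1)$. The reverse of $Z=(f_1,\dots,f_l)$ is the zigzag $Z^t=(f_l^t,\dots,f_1^t)$. A zigzag is identified with its reverse (so zigzags are counted up to reversal). $Z$ has no self-intersections if for no flag $f$ of $Z$ does $\sigma_1(f)$ belong to $Z$ or $Z^t$. For two distinct zigzags $Z_1=(f_{1},\dots,f_{l})$ and $Z_2$, $n_I$ is the number of $j$ with $\sigma_1(f_j)\in Z_2$ and $n_{II}$ the number of $j$ with $\sigma_1(f_j)\in Z_2^t$; replacing $Z_2$ by $Z_2^t$ exchanges the two numbers, and the normalized signature is the pair $(n_I,n_{II})$ with orientation chosen so that $n_I\le n_{II}$. The intersection vector $\mathrm{Int}$ of a zigzag $Z$ is the list of its nonzero normalized signatures with all other zigzags, multiplicities being written as exponents: $(0,1)^d$ means that $Z$ has normalized signature $(0,1)$ with exactly $d$ other zigzags and $(0,0)$ with all remaining ones. -}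

module Defs where

open import Data.Fin.Base using (Fin; toℕ; opposite) renaming (_≤_ to _≤ᶠ_)
open import Data.Fin.Subset using (Subset; _∈_; ∣_∣)
open import Data.List.Base using (List)
open import Data.List.Relation.Binary.Pointwise using (Pointwise)
open import Data.List.Relation.Unary.All using (All)
open import Data.List.Relation.Unary.AllPairs using (AllPairs)
open import Data.List.Relation.Unary.Any using (Any)
open import Data.Maybe.Base as Maybe using (Maybe; nothing; just; is-nothing)
open import Data.Nat.Base using (ℕ; zero; suc; _+_; _≤_; _<_; NonZero)
open import Data.Nat.DivMod using (_mod_)
open import Data.Product.Base using (Σ; ∃; _×_; _,_)
open import Data.Sign.Base using (Sign) renaming (opposite to flip)
open import Data.Sum.Base using (_⊎_)
open import Data.Vec.Base using (Vec; lookup; map; countᵇ)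
open import Function.Bundles using (_⇔_)
open import Relation.Binary.PropositionalEquality.Core using (_≡_; _≢_)
open import Relation.Nullary.Negation.Core using (¬_)

-- A nonempty face of the cube [-1,1]^d, as a sign vector: it consists of the
-- points whose k-th coordinate is ±1 wherever the k-th entry is  just ± ;
-- the coordinates with entry  nothing  are free.  The all-free vector is the
-- cube itself; every other vector is a proper face.

Face : ℕ → Set
Face d = Vec (Maybe Sign) d

module _ {d : ℕ} where

  dim : Face d → ℕ
  dim = countᵇ is-nothing

  neg : Face d → Face d
  neg = map (Maybe.map flip)

  infix 4 _⊆_ _≈_ _⊑_

  _⊆_ : Face d → Face d → Set
  F ⊆ G = ∀ k s → lookup G k ≡ just s → lookup F k ≡ just s

  -- The element {F , -F} of the folded cube is represented by either F or -F:
  -- _≈_ is equality, and _⊑_ the order, of the represented elements.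

  _≈_ : Face d → Face d → Set
  F ≈ G = F ≡ G ⊎ F ≡ neg G

  _⊑_ : Face d → Face d → Set
  F ⊑ G = F ⊆ G ⊎ neg F ⊆ G

-- A flag (0, x₁, …, x_d, 1) of the folded d-cube.  The smallest and greatest
-- elements belong to every flag and are left out; x_i is  elem  at the index
-- with toℕ equal to i - 1, which is also its dimension (so it is proper).

record Flag (d : ℕ) : Set where
  field
    elem     : Fin d → Face d
    dim-elem : ∀ i → dim (elem i) ≡ toℕ i
    chain    : ∀ {i j} → i ≤ᶠ j → elem i ⊑ elem j

open Flag public

module _ {d : ℕ} where

  infix 4 _≈ᶠ_

  _≈ᶠ_ : Flag d → Flag d → Set
  f ≈ᶠ g = ∀ i → elem f i ≈ elem g i

  -- Flags are only compared up to _≈ᶠ_, so operations on flags are given by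
  -- their graphs.  σ k f g  says  g = σ_k (f), with k counted from 1: g is the
  -- flag obtained from f by replacing x_k, and only x_k, by another element.
  -- That this element lies between x_{k-1} and x_{k+1} is part of g being a flag.

  σ : ℕ → Flag d → Flag d → Set
  σ k f g = ∀ i → (suc (toℕ i) ≡ k → ¬ (elem g i ≈ elem f i))
                × (suc (toℕ i) ≢ k → elem g i ≈ elem f i)

  -- g = σ_k (… (σ_1 (f)) …)
  σ-upTo : ℕ → Flag d → Flag d → Set
  σ-upTo zero    f g = f ≈ᶠ g
  σ-upTo (suc k) f g = ∃ λ h → σ-upTo k f h × σ (suc k) h g

  T : Flag d → Flag d → Set
  T = σ-upTo d

  -- The triangular family attached to f, with both indices counted from 0:
  -- x i j  is  x_{i+1,j+1}.  Only the values with i + j < d matter.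

  record Triangle (f : Flag d) : Set where
    field
      x      : ℕ → ℕ → Face d
      first  : ∀ i → x (toℕ i) 0 ≈ elem f i
      dim-x  : ∀ {i j} → i + j < d → dim (x i j) ≡ i
      up     : ∀ {i j} → suc i + j < d → x i j ⊑ x (suc i) j
      cross  : ∀ {i j} → i + suc j < d → x i (suc j) ⊑ x (suc i) j
      change : ∀ {i j} → i + suc j < d → ¬ (x i (suc j) ≈ x i j)

  -- IsReverse f g  says  g = f^t.
  IsReverse : Flag d → Flag d → Set
  IsReverse f g = Σ (Triangle f) λ t →
    ∀ i → elem g i ≈ Triangle.x t (toℕ i) (toℕ (opposite i))

-- flag  lists one orbit of T, each flag of the orbit exactly once.

record Zigzag (d : ℕ) : Set where
  field
    len         : ℕ
    {{nonEmpty}} : NonZero len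
    flag        : Fin len → Flag d

  -- The flag at a position read modulo the length.
  at : ℕ → Flag d
  at n = flag (n mod len)

  field
    step     : ∀ j → T (flag j) (at (suc (toℕ j)))
    distinct : ∀ {i j} → flag i ≈ᶠ flag j → i ≡ j

open Zigzag public using (len; flag; at)

module _ {d : ℕ} where

  infix 4 _∈ᶻ_ _∈ᵗ_ _∼_

  _∈ᶻ_ : Flag d → Zigzag d → Set
  f ∈ᶻ Z = ∃ λ j → f ≈ᶠ flag Z j

  -- f ∈ᵗ Z  says that f belongs to the reverse of Z.
  _∈ᵗ_ : Flag d → Zigzag d → Set
  f ∈ᵗ Z = ∃ λ j → IsReverse (flag Z j) f

  -- W = Z up to a cyclic shift
  IsShift : Zigzag d → Zigzag d → Set
  IsShift Z W = len W ≡ len Z ×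
    ∃ λ k → ∀ j → at W (k + toℕ j) ≈ᶠ flag Z j

  -- W = Z^t = (f_l^t, …, f_1^t) up to a cyclic shift
  IsReverseᶻ : Zigzag d → Zigzag d → Set
  IsReverseᶻ Z W = len W ≡ len Z ×
    ∃ λ k → ∀ j → IsReverse (flag Z j) (at W (k + toℕ (opposite j)))

  -- Equality of zigzags, each being identified with its reverse
  _∼_ : Zigzag d → Zigzag d → Set
  Z ∼ W = IsShift Z W ⊎ IsReverseᶻ Z W

  -- σ₁(f) ∈ Z  and  σ₁(f) ∈ Z^t
  σ₁∈ σ₁∈ᵗ : Flag d → Zigzag d → Set
  σ₁∈  f Z = ∃ λ g → σ 1 f g × g ∈ᶻ Z
  σ₁∈ᵗ f Z = ∃ λ g → σ 1 f g × g ∈ᵗ Z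

  NoSelfIntersections : Zigzag d → Set
  NoSelfIntersections Z = ∀ j → ¬ σ₁∈ (flag Z j) Z × ¬ σ₁∈ᵗ (flag Z j) Z

-- Exactly n indices satisfy P.
HasCount : ∀ {l} → (Fin l → Set) → ℕ → Set
HasCount {l} P n = ∃ λ (S : Subset l) → ∣ S ∣ ≡ n × (∀ j → j ∈ S ⇔ P j)

module _ {d : ℕ} where

  Signature : Zigzag d → Zigzag d → ℕ × ℕ → Set
  Signature Z W (nI , nII) =
    HasCount (λ j → σ₁∈ (flag Z j) W) nI × HasCount (λ j → σ₁∈ᵗ (flag Z j) W) nII

  -- Passing from W to W^t exchanges the two numbers.
  NormalizedSignature : Zigzag d → Zigzag d → ℕ × ℕ → Set
  NormalizedSignature Z W (m , n) =
    m ≤ n × (Signature Z W (m , n) ⊎ Signature Z W (n , m))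

  -- Int is the list of nonzero normalized signatures of Z with the other
  -- zigzags; these are listed, without repetition, in  partners .

  record IntersectionVector (Z : Zigzag d) (Int : List (ℕ × ℕ)) : Set where
    field
      partners   : List (Zigzag d)
      pairwise   : AllPairs (λ V W → ¬ (V ∼ W)) partners
      other      : All (λ W → ¬ (Z ∼ W)) partners
      signatures : Pointwise (NormalizedSignature Z) partners Int
      nonzero    : All (_≢ (0 , 0)) Int
      remaining  : ∀ W → ¬ (Z ∼ W) →
                   Any (_∼ W) partners ⊎ NormalizedSignature Z W (0 , 0)

{-# OPTIONS --safe #-}
module Submission where

-- A flag of the cube is a vertex v followed by the order π in which the coordinates are freed;
-- a flag of the folded cube is such a pair (v , π) up to v ↦ -v.  In these terms T flips v at
-- π₀ and rotates π, so that T^d (v , π) = (-v , π) and every zigzag has length d.  The reversed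
-- zigzag is the orbit of (v , π read backwards); for d ≥ 3 no cyclic order is its own reverse.
-- σ₁ changes v only, so the zigzag of (v , π) meets exactly those of (v flipped at k , π), each
-- of them once.  For the count, rotate π until it starts with the coordinate 0: the signs of 0
-- and 1 can then be made + by negation and reversal, which leaves 2^(d-2) (d-1)! normal forms.

open import Defs
open import Data.Fin.Base using (Fin; zero; suc; toℕ; fromℕ; fromℕ<; inject₁; opposite; punchIn; punchOut; combine; remQuot; finToFun; funToFin)
open import Data.Fin.Permutation as Perm using (Permutation′; permutation; _⟨$⟩ʳ_; _⟨$⟩ˡ_; _∘ₚ_; reverse; lift₀; insert; remove)
import Data.Fin.Properties as Fin
open import Data.Fin.Relation.Unary.Top using (view; ‵fromℕ; ‵inject₁; view-fromℕ; view-inject₁)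
open import Data.Fin.Subset using (⊥; ⁅_⁆; _∈_)
open import Data.Fin.Subset.Properties using (∉⊥; ∣⊥∣≡0; ∣⁅x⁆∣≡1; x∈⁅x⁆; x∈⁅y⁆⇒x≡y)
open import Data.List.Base using (replicate) renaming (tabulate to tabulateˡ)
open import Data.List.Relation.Binary.Pointwise using (Pointwise; []; _∷_)
import Data.List.Relation.Unary.All.Properties as All
import Data.List.Relation.Unary.AllPairs.Properties as AllPairs
import Data.List.Relation.Unary.Any.Properties as Any
open import Data.Maybe.Base as Maybe using (Maybe; nothing; just)
open import Data.Maybe.Properties using (just-injective)
open import Data.Nat.Base using (ℕ; zero; suc; 2+; _+_; _*_; _∸_; _^_; _!; _≤_; _<_; z≤n; s≤s; z<s; s<s; NonZero)
open import Data.Nat.Divisibility using (∣-antisym; m%n≡0⇒n∣m)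
open import Data.Nat.DivMod using (_/_; _%_; _mod_; m≡m%n+[m/n]*n; m%n<n; m%n%n≡m%n; n%n≡0; m<n⇒m%n≡m; [m+n]%n≡m%n; %-distribˡ-+)
import Data.Nat.Properties as ℕ
open import Data.Product.Base using (Σ; ∃; _×_; _,_; proj₁; proj₂)
open import Data.Sign.Base using (Sign) renaming (opposite to flip)
import Data.Sign.Properties as Sign
open import Data.Sum.Base as Sum using (_⊎_; inj₁; inj₂)
open import Data.Vec.Base using (Vec; []; _∷_; lookup; map; tabulate; _[_]≔_; _[_]%=_) renaming (replicate to replicateᵛ)
import Data.Vec.Properties as Vec
open import Function.Base using (_∘_; case_of_)
open import Function.Bundles using (mk⇔)
open import Function.Definitions using (Bijective)
open import Relation.Binary.Definitions using (tri<; tri≈; tri>)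
open import Relation.Binary.PropositionalEquality
open import Relation.Nullary.Decidable using (Dec; yes; no; map′; _×-dec_; _⊎-dec_)
open import Relation.Nullary.Negation.Core using (¬_; contradiction)

-- Elements are given up to sign, and `σ`, `T` and `IsReverse` only as relations between arbitrary
-- flags. Passing to pairs (v , π) therefore takes two facts: every flag is equivalent to the flag
-- of a code, and each relation determines its result up to equivalence. The second is the diamond
-- property: an interval of length two has just two inner elements. After that, exhibiting one
-- result per relation on codes suffices. What is left is a dihedral action: `shift` and `op`
-- satisfy shift ∘ op ∘ shift = op, so reversal carries orbits to orbits. The number can be
-- foreseen: there are 2^(d-1) d! codes up to negation, an orbit has d of them, and reversal pairs
-- the orbits without fixing one. The hypothesis d ≥ 3 enters in two ways. A coordinate must have
-- different neighbours in the cyclic order, or an orbit could be its own reverse; and flips at two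
-- coordinates must leave a third one untouched, since for d = 2 the two flips differ by a negation
-- and give the same partner.

private variable
  d n : ℕ

lookup-injective : ∀ {A : Set} {xs ys : Vec A n} → (∀ k → lookup xs k ≡ lookup ys k) → xs ≡ ys
lookup-injective {xs = xs} {ys} eq =
  trans (sym (Vec.tabulate∘lookup xs)) (trans (Vec.tabulate-cong eq) (Vec.tabulate∘lookup ys))

≢⇒≡flip : ∀ {s t : Sign} → s ≢ t → s ≡ flip t
≢⇒≡flip {Sign.+} {Sign.+} p = contradiction refl p
≢⇒≡flip {Sign.+} {Sign.-} p = refl
≢⇒≡flip {Sign.-} {Sign.+} p = refl
≢⇒≡flip {Sign.-} {Sign.-} p = contradiction refl p

-- Faces

module _ {d : ℕ} where

  infix 4 _≲_

  -- The order with signs forgotten. It does not change under `neg`, so dimension counts need no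
  -- choice of representatives.
  _≲_ : Face d → Face d → Set
  F ≲ G = ∀ k → lookup F k ≡ nothing → lookup G k ≡ nothing

  lookup-neg : ∀ (F : Face d) k → lookup (neg F) k ≡ Maybe.map flip (lookup F k)
  lookup-neg F k = Vec.lookup-map k _ F

  neg-involutive : ∀ (F : Face d) → neg (neg F) ≡ F
  neg-involutive F = trans (sym (Vec.map-∘ _ _ F)) (trans (Vec.map-cong pointwise F) (Vec.map-id F))
    where
    pointwise : ∀ x → Maybe.map flip (Maybe.map flip x) ≡ x
    pointwise nothing  = refl
    pointwise (just s) = cong just (Sign.opposite-involutive s)

  ≲-trans : ∀ {F G H : Face d} → F ≲ G → G ≲ H → F ≲ H
  ≲-trans p q k = q k ∘ p k

  neg≲ : ∀ {F : Face d} → neg F ≲ F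
  neg≲ {F} k eq with lookup F k | lookup-neg F k
  ... | nothing | _  = refl
  ... | just s  | eq′ = case trans (sym eq) eq′ of λ ()

  ≲neg : ∀ {F : Face d} → F ≲ neg F
  ≲neg {F} k eq = trans (lookup-neg F k) (cong (Maybe.map flip) eq)

  ⊆⇒≲ : ∀ {F G : Face d} → F ⊆ G → F ≲ G
  ⊆⇒≲ {F} {G} F⊆G k eq with lookup G k in eq′
  ... | nothing = refl
  ... | just s  = case trans (sym eq) (F⊆G k s eq′) of λ ()

  ⊑⇒≲ : ∀ {F G : Face d} → F ⊑ G → F ≲ G
  ⊑⇒≲ {F} {G} (inj₁ p) = ⊆⇒≲ {F} {G} p
  ⊑⇒≲ {F} {G} (inj₂ p) = ≲-trans {F} {neg F} {G} (≲neg {F}) (⊆⇒≲ {neg F} {G} p)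

  ⊆-refl : ∀ {F : Face d} → F ⊆ F
  ⊆-refl k s eq = eq

  ⊆-trans : ∀ {F G H : Face d} → F ⊆ G → G ⊆ H → F ⊆ H
  ⊆-trans p q k s = p k s ∘ q k s

  neg-⊆ : ∀ {F G : Face d} → F ⊆ G → neg F ⊆ neg G
  neg-⊆ {F} {G} F⊆G k s eq with lookup G k in eqG | lookup-neg G k
  ... | nothing | eq′ = case trans (sym eq) eq′ of λ ()
  ... | just t  | eq′ = trans (lookup-neg F k)
    (trans (cong (Maybe.map flip) (F⊆G k t eqG)) (trans (sym eq′) eq))

  neg⊆⇒⊆neg : ∀ {F G : Face d} → neg F ⊆ G → F ⊆ neg G
  neg⊆⇒⊆neg {F} {G} p = subst (_⊆ neg G) (neg-involutive F) (neg-⊆ {neg F} {G} p)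

  ⊆neg⇒neg⊆ : ∀ {F G : Face d} → F ⊆ neg G → neg F ⊆ G
  ⊆neg⇒neg⊆ {F} {G} p = subst (neg F ⊆_) (neg-involutive G) (neg-⊆ {F} {neg G} p)

  ≈-refl : ∀ {F : Face d} → F ≈ F
  ≈-refl = inj₁ refl

  ≈-sym : ∀ {F G : Face d} → F ≈ G → G ≈ F
  ≈-sym (inj₁ p) = inj₁ (sym p)
  ≈-sym {G = G} (inj₂ p) = inj₂ (sym (trans (cong neg p) (neg-involutive G)))

  ≈-trans : ∀ {F G H : Face d} → F ≈ G → G ≈ H → F ≈ H
  ≈-trans (inj₁ refl) q = q
  ≈-trans (inj₂ refl) (inj₁ refl) = inj₂ refl
  ≈-trans {H = H} (inj₂ refl) (inj₂ refl) = inj₁ (neg-involutive H)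

  ≈⇒≲ : ∀ {F G : Face d} → F ≈ G → F ≲ G
  ≈⇒≲ (inj₁ refl) k eq = eq
  ≈⇒≲ {G = G} (inj₂ refl) = neg≲ {G}

  ⊑-respˡ : ∀ {F F′ G : Face d} → F ≈ F′ → F ⊑ G → F′ ⊑ G
  ⊑-respˡ (inj₁ refl) p = p
  ⊑-respˡ (inj₂ refl) (inj₁ p) = inj₂ p
  ⊑-respˡ {F′ = F′} {G} (inj₂ refl) (inj₂ p) = inj₁ (subst (_⊆ G) (neg-involutive F′) p)

  ⊑-respʳ : ∀ {F G G′ : Face d} → G ≈ G′ → F ⊑ G → F ⊑ G′
  ⊑-respʳ (inj₁ refl) p = p
  ⊑-respʳ {F} {G′ = G′} (inj₂ refl) (inj₁ p) = inj₂ (⊆neg⇒neg⊆ {F} {G′} p)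
  ⊑-respʳ {F} {G′ = G′} (inj₂ refl) (inj₂ p) = inj₁
    (subst (_⊆ G′) (neg-involutive F) (⊆neg⇒neg⊆ {neg F} {G′} p))

  ⊑⇒⊆ʳ : ∀ {F G : Face d} → F ⊑ G → ∃ λ G′ → G′ ≈ G × F ⊆ G′
  ⊑⇒⊆ʳ {G = G} (inj₁ p) = G , ≈-refl , p
  ⊑⇒⊆ʳ {F} {G} (inj₂ p) = neg G , inj₂ refl , neg⊆⇒⊆neg {F} {G} p

  ⊑⇒⊆ˡ : ∀ {F G : Face d} → F ⊑ G → ∃ λ F′ → F′ ≈ F × F′ ⊆ G
  ⊑⇒⊆ˡ {F} (inj₁ p) = F , ≈-refl , p
  ⊑⇒⊆ˡ {F} (inj₂ p) = neg F , inj₂ refl , p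

dim-mono : ∀ {F G : Face d} → F ≲ G → dim F ≤ dim G
dim-mono {F = []} {[]} p = z≤n
dim-mono {F = nothing ∷ F} {nothing ∷ G} p = s≤s (dim-mono {F = F} {G} (p ∘ suc))
dim-mono {F = nothing ∷ F} {just _  ∷ G} p = case p zero refl of λ ()
dim-mono {F = just _  ∷ F} {nothing ∷ G} p = ℕ.m≤n⇒m≤1+n (dim-mono {F = F} {G} (p ∘ suc))
dim-mono {F = just _  ∷ F} {just _  ∷ G} p = dim-mono {F = F} {G} (p ∘ suc)

dim-cong : ∀ {F G : Face d} → F ≈ G → dim F ≡ dim G
dim-cong {F = F} {G} p = ℕ.≤-antisym
  (dim-mono {F = F} {G} (≈⇒≲ {F = F} {G} p))
  (dim-mono {F = G} {F} (≈⇒≲ {F = G} {F} (≈-sym p)))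

dim-free : ∀ (F : Face d) k {s} → lookup F k ≡ just s → dim (F [ k ]≔ nothing) ≡ suc (dim F)
dim-free (just _  ∷ F) zero    eq = refl
dim-free (nothing ∷ F) (suc k) eq = cong suc (dim-free F k eq)
dim-free (just _  ∷ F) (suc k) eq = dim-free F k eq

⊆-dim≡⇒≡ : ∀ {F G : Face d} → F ⊆ G → dim G ≡ dim F → G ≡ F
⊆-dim≡⇒≡ {F = []} {[]} p eq = refl
⊆-dim≡⇒≡ {F = nothing ∷ F} {nothing ∷ G} p eq = cong (nothing ∷_) (⊆-dim≡⇒≡ {F = F} {G} (p ∘ suc) (ℕ.suc-injective eq))
⊆-dim≡⇒≡ {F = nothing ∷ F} {just s  ∷ G} p eq = case p zero s refl of λ ()
⊆-dim≡⇒≡ {F = just _  ∷ F} {nothing ∷ G} p eq =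
  contradiction (dim-mono {F = F} {G} (⊆⇒≲ {F = F} {G} (p ∘ suc))) (ℕ.<⇒≱ (ℕ.≤-reflexive eq))
⊆-dim≡⇒≡ {F = just _  ∷ F} {just s  ∷ G} p eq = cong₂ _∷_ (sym (p zero s refl)) (⊆-dim≡⇒≡ {F = F} {G} (p ∘ suc) eq)

-- A larger face keeps the signs that it still fixes, so one extra dimension is one released
-- coordinate. This turns chains of faces into sequences of coordinates.
⊆-cover : ∀ {F G : Face d} → F ⊆ G → dim G ≡ suc (dim F) →
          ∃ λ k → (∃ λ s → lookup F k ≡ just s) × G ≡ F [ k ]≔ nothing
⊆-cover {F = []} {[]} p ()
⊆-cover {F = nothing ∷ F} {nothing ∷ G} p eq with ⊆-cover {F = F} {G} (p ∘ suc) (ℕ.suc-injective eq)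
... | k , fixed , refl = suc k , fixed , refl
⊆-cover {F = nothing ∷ F} {just s  ∷ G} p eq = case p zero s refl of λ ()
⊆-cover {F = just s  ∷ F} {nothing ∷ G} p eq =
  zero , (s , refl) , cong (nothing ∷_) (⊆-dim≡⇒≡ {F = F} {G} (p ∘ suc) (ℕ.suc-injective eq))
⊆-cover {F = just _  ∷ F} {just s  ∷ G} p eq with p zero s refl | ⊆-cover {F = F} {G} (p ∘ suc) eq
... | refl | k , fixed , refl = suc k , fixed , refl

module _ {d : ℕ} where

  lookup-free : ∀ (F : Face d) k → lookup (F [ k ]≔ nothing) k ≡ nothing
  lookup-free F k = Vec.lookup∘update k F nothing

  ⊆-free : ∀ (F : Face d) k → F ⊆ F [ k ]≔ nothing
  ⊆-free F k j s eq with j Fin.≟ k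
  ... | yes refl = case trans (sym (lookup-free F k)) eq of λ ()
  ... | no j≢k   = trans (sym (Vec.lookup∘update′ j≢k F nothing)) eq

  free-≲ : ∀ {F G : Face d} {k} → F ≲ G → lookup G k ≡ nothing → F [ k ]≔ nothing ≲ G
  free-≲ {F} {k = k} p eq j eq′ with j Fin.≟ k
  ... | yes refl = eq
  ... | no j≢k   = p j (trans (sym (Vec.lookup∘update′ j≢k F nothing)) eq′)

  -- Below, the third of three faces covering L inside U would free a third
  -- coordinate; U need not contain them as faces, so U may be the whole cube.
  diamond-⊆ : ∀ {L x y z U : Face d} → L ⊆ x → L ⊆ y → L ⊆ z →
              dim x ≡ suc (dim L) → dim y ≡ suc (dim L) → dim z ≡ suc (dim L) →
              x ≲ U → y ≲ U → z ≲ U → dim U ≡ suc (suc (dim L)) →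
              x ≢ y → x ≢ z → y ≡ z
  diamond-⊆ {L} {x} {y} {z} {U} Lx Ly Lz dx dy dz xU yU zU dU x≢y x≢z
    with ⊆-cover {F = L} {x} Lx dx | ⊆-cover {F = L} {y} Ly dy | ⊆-cover {F = L} {z} Lz dz
  ... | p , (_ , Lp) , refl | q , (_ , Lq) , refl | r , (_ , Lr) , refl
    with q Fin.≟ r
  ... | yes refl = refl
  ... | no q≢r = contradiction
    (subst (_≤ dim U) dim-Lpqr (dim-mono {F = Lpqr} {U}
      (free-≲ {Lp′ [ q ]≔ nothing} {U} (free-≲ {Lp′} {U} xU (yU q (lookup-free L q))) (zU r (lookup-free L r)))))
    (ℕ.<⇒≱ (s≤s (ℕ.≤-reflexive dU)))
    where
    Lp′  = L [ p ]≔ nothing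
    Lpqr = Lp′ [ q ]≔ nothing [ r ]≔ nothing
    p≢q : p ≢ q
    p≢q refl = x≢y refl
    p≢r : p ≢ r
    p≢r refl = x≢z refl
    dim-Lpqr : dim Lpqr ≡ suc (suc (suc (dim L)))
    dim-Lpqr = trans
      (dim-free (Lp′ [ q ]≔ nothing) r
        (trans (Vec.lookup∘update′ (q≢r ∘ sym) Lp′ nothing)
          (trans (Vec.lookup∘update′ (p≢r ∘ sym) L nothing) Lr)))
      (cong suc (trans (dim-free Lp′ q (trans (Vec.lookup∘update′ (p≢q ∘ sym) L nothing) Lq))
        (cong suc (dim-free L p Lp))))

  -- With `L` held fixed, each of the three elements has a representative containing `L`, and
  -- `diamond-⊆` applies to these. `U` enters only through its free coordinates, so no sign has to
  -- be chosen for it.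
  diamond : ∀ {L x y z U : Face d} → L ⊑ x → L ⊑ y → L ⊑ z →
            dim x ≡ suc (dim L) → dim y ≡ dim x → dim z ≡ dim x →
            x ≲ U → y ≲ U → z ≲ U → dim U ≡ suc (dim x) →
            ¬ (y ≈ x) → ¬ (z ≈ x) → y ≈ z
  diamond {L} {x} {y} {z} {U} Lx Ly Lz dx dy dz xU yU zU dU y≉x z≉x
    with ⊑⇒⊆ʳ {F = L} {x} Lx | ⊑⇒⊆ʳ {F = L} {y} Ly | ⊑⇒⊆ʳ {F = L} {z} Lz
  ... | x′ , x′≈x , Lx′ | y′ , y′≈y , Ly′ | z′ , z′≈z , Lz′ =
    ≈-trans (≈-sym y′≈y) (≈-trans (inj₁ y′≡z′) z′≈z)
    where
    y′≡z′ : y′ ≡ z′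
    y′≡z′ = diamond-⊆ {L} {x′} {y′} {z′} {U} Lx′ Ly′ Lz′
      (trans (dim-cong x′≈x) dx) (trans (dim-cong y′≈y) (trans dy dx)) (trans (dim-cong z′≈z) (trans dz dx))
      (≲-trans {F = x′} {x} {U} (≈⇒≲ x′≈x) xU) (≲-trans {F = y′} {y} {U} (≈⇒≲ y′≈y) yU)
      (≲-trans {F = z′} {z} {U} (≈⇒≲ z′≈z) zU) (trans dU (cong suc dx))
      (λ { refl → y≉x (≈-trans (≈-sym y′≈y) x′≈x) })
      (λ { refl → z≉x (≈-trans (≈-sym z′≈z) x′≈x) })

  -- Replaces the diamond property at the bottom of a flag, where the smallest element is not a face
  -- and cannot serve as `L`. A vertex of the edge `U` is determined by its sign at the free
  -- coordinate `p`, and there are only two signs.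
  edge-⊆ : ∀ {x y z U : Face d} → x ⊆ U → y ⊆ U → z ⊆ U →
           dim x ≡ 0 → dim y ≡ 0 → dim z ≡ 0 → dim U ≡ 1 →
           x ≢ y → x ≢ z → y ≡ z
  edge-⊆ {x} {y} {z} {U} xU yU zU dx dy dz dU x≢y x≢z
    with ⊆-cover {F = x} {U} xU (trans dU (cong suc (sym dx)))
  ... | p , (s , xp) , eqU = y≡z
    where
    fixed : ∀ (F : Face d) → dim F ≡ 0 → ∀ k → ∃ λ t → lookup F k ≡ just t
    fixed F dF k with lookup F k in eq
    ... | just t = t , refl
    -- If `k` were free in `F`, an arbitrary vertex with `k` released would lie below `F` for `_≲_`
    -- and have dimension 1.
    ... | nothing = contradiction (dim-mono {F = zeros [ k ]≔ nothing} {F} free≲)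
        (λ le → case subst₂ _≤_ (dim-free zeros k (Vec.lookup-replicate k _)) dF le of λ ())
      where
      zeros : Face d
      zeros = replicateᵛ d (just s)
      free≲ : zeros [ k ]≔ nothing ≲ F
      free≲ = free-≲ {zeros} {F} (λ j e → case trans (sym (Vec.lookup-replicate j _)) e of λ ()) eq
    off : ∀ {F} → F ⊆ U → ∀ {k} → k ≢ p → lookup F k ≡ lookup x k
    off {F} FU {k} k≢p with fixed x dx k
    ... | t , xk = trans (FU k t (trans (cong (λ V → lookup V k) eqU) (trans (Vec.lookup∘update′ k≢p x nothing) xk))) (sym xk)
    at-p : ∀ {F} → F ⊆ U → dim F ≡ 0 → x ≢ F → lookup F p ≡ just (flip s)
    at-p {F} FU dF x≢F with fixed F dF p
    ... | t , Fp = trans Fp (cong just (≢⇒≡flip λ { refl → x≢F (lookup-injective λ k → case k Fin.≟ p of λ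
      { (yes refl) → trans xp (sym Fp) ; (no k≢p) → sym (off {F} FU k≢p) }) }))
    y≡z : y ≡ z
    y≡z = lookup-injective λ k → case k Fin.≟ p of λ
      { (yes refl) → trans (at-p {y} yU dy x≢y) (sym (at-p {z} zU dz x≢z))
      ; (no k≢p)   → trans (off {y} yU k≢p) (sym (off {z} zU k≢p)) }

  edge : ∀ {x y z U : Face d} → x ⊑ U → y ⊑ U → z ⊑ U →
         dim x ≡ 0 → dim y ≡ 0 → dim z ≡ 0 → dim U ≡ 1 →
         ¬ (y ≈ x) → ¬ (z ≈ x) → y ≈ z
  edge {x} {y} {z} {U} xU yU zU dx dy dz dU y≉x z≉x
    with ⊑⇒⊆ˡ {F = x} {U} xU | ⊑⇒⊆ˡ {F = y} {U} yU | ⊑⇒⊆ˡ {F = z} {U} zU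
  ... | x′ , x′≈x , x′U | y′ , y′≈y , y′U | z′ , z′≈z , z′U =
    ≈-trans (≈-sym y′≈y) (≈-trans (inj₁ y′≡z′) z′≈z)
    where
    y′≡z′ : y′ ≡ z′
    y′≡z′ = edge-⊆ {x′} {y′} {z′} {U} x′U y′U z′U (trans (dim-cong x′≈x) dx) (trans (dim-cong y′≈y) dy) (trans (dim-cong z′≈z) dz) dU
      (λ { refl → y≉x (≈-trans (≈-sym y′≈y) x′≈x) })
      (λ { refl → z≉x (≈-trans (≈-sym z′≈z) x′≈x) })

-- Flags

module _ {d : ℕ} where

  ≈ᶠ-refl : ∀ {f : Flag d} → f ≈ᶠ f
  ≈ᶠ-refl i = ≈-refl

  ≈ᶠ-sym : ∀ {f g : Flag d} → f ≈ᶠ g → g ≈ᶠ f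
  ≈ᶠ-sym p i = ≈-sym (p i)

  ≈ᶠ-trans : ∀ {f g h : Flag d} → f ≈ᶠ g → g ≈ᶠ h → f ≈ᶠ h
  ≈ᶠ-trans p q i = ≈-trans (p i) (q i)

  σ-resp : ∀ {k} {f f′ g g′ : Flag d} → f ≈ᶠ f′ → g ≈ᶠ g′ → σ k f g → σ k f′ g′
  σ-resp p q s i =
    (λ eq g≈f → proj₁ (s i) eq (≈-trans (q i) (≈-trans g≈f (≈-sym (p i))))) ,
    (λ neq → ≈-trans (≈-sym (q i)) (≈-trans (proj₂ (s i) neq) (p i)))

  σ-upTo-resp : ∀ k {f f′ g g′ : Flag d} → f ≈ᶠ f′ → g ≈ᶠ g′ → σ-upTo k f g → σ-upTo k f′ g′
  σ-upTo-resp zero {f} p q s i = ≈-trans (≈-sym (p i)) (≈-trans (s i) (q i))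
  σ-upTo-resp (suc k) {f} {f′} {g} {g′} p q (h , s , s′) =
    h , σ-upTo-resp k {f} {f′} {h} {h} p (≈ᶠ-refl {h}) s ,
    σ-resp {suc k} {h} {h} {g} {g′} (≈ᶠ-refl {h}) q s′

  -- The cube itself stands for the greatest element: it is the upper bound when the top element of
  -- a flag is exchanged, and it ends the chain from which a code is read off.
  full : Face d
  full = replicateᵛ d nothing

  ≲-full : ∀ {F : Face d} → F ≲ full
  ≲-full k eq = Vec.lookup-replicate k nothing

dim-full : ∀ d → dim (full {d}) ≡ d
dim-full zero    = refl
dim-full (suc d) = cong suc (dim-full d)

toℕ-opposite : ∀ (i : Fin n) → suc (toℕ i + toℕ (opposite i)) ≡ n
toℕ-opposite {suc n} i = cong suc (trans (cong (toℕ i +_) (Fin.opposite-prop i)) (ℕ.m+[n∸m]≡n (ℕ.≤-pred (Fin.toℕ<n i))))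

-- Uniqueness of σ, T and the reverse

module _ {n : ℕ} where

  -- The old element and both new ones lie between the same two neighbours, and `diamond`, or `edge`
  -- at the bottom, leaves room for a single new one.
  σ-unique : ∀ k {f f′ g g′ : Flag (2+ n)} → f ≈ᶠ f′ → σ k f g → σ k f′ g′ → g ≈ᶠ g′
  σ-unique k {f} {f′} {g} {g′} f≈f′ s s″ i with suc (toℕ i) ℕ.≟ k
  ... | no  i≢k = ≈-trans (proj₂ (s i) i≢k) (≈-trans (f≈f′ i) (≈-sym (proj₂ (s″ i) i≢k)))
  ... | yes refl = changed i refl
    where
    s′ : σ k f g′
    s′ = σ-resp {2+ n} {k} {f′} {f} {g′} {g′} (≈ᶠ-sym {2+ n} {f} {f′} f≈f′) (≈ᶠ-refl {2+ n} {g′}) s″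

    agree : ∀ {h} → σ k f h → ∀ {j} → suc (toℕ j) ≢ k → elem h j ≈ elem f j
    agree t {j} = proj₂ (t j)

    dim≡ : ∀ h i → dim (elem h i) ≡ dim (elem f i)
    dim≡ h i = trans (dim-elem h i) (sym (dim-elem f i))

    upper : ∀ i → suc (toℕ i) ≡ k → ∃ λ U → dim U ≡ suc (dim (elem f i)) ×
            elem f i ≲ U × elem g i ≲ U × elem g′ i ≲ U
    upper i eq with suc (toℕ i) ℕ.<? (2+ n)
    ... | yes i+1<d = elem f j , trans (dim-elem f j) (trans toℕ-j (cong suc (sym (dim-elem f i)))) ,
          ⊑⇒≲ {F = elem f i} {elem f j} (chain f i≤j) , below g s , below g′ s′
      where
      j = fromℕ< i+1<d
      toℕ-j : toℕ j ≡ suc (toℕ i)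
      toℕ-j = Fin.toℕ-fromℕ< i+1<d
      i≤j : toℕ i ≤ toℕ j
      i≤j = subst (toℕ i ≤_) (sym toℕ-j) (ℕ.n≤1+n _)
      below : ∀ h → σ k f h → elem h i ≲ elem f j
      below h t = ⊑⇒≲ {F = elem h i} {elem f j} (⊑-respʳ {F = elem h i}
        (agree {h} t λ eq′ → ℕ.1+n≢n (trans (sym toℕ-j) (ℕ.suc-injective (trans eq′ (sym eq)))))
        (chain h i≤j))
    ... | no i+1≮d = full , trans (dim-full (2+ n)) (trans d≡ (cong suc (sym (dim-elem f i)))) ,
          ≲-full {F = elem f i} , ≲-full {F = elem g i} , ≲-full {F = elem g′ i}
      where
      d≡ : (2+ n) ≡ suc (toℕ i)
      d≡ = ℕ.≤-antisym (ℕ.≮⇒≥ i+1≮d) (Fin.toℕ<n i)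

    changed : ∀ i → suc (toℕ i) ≡ k → elem g i ≈ elem g′ i
    changed zero eq = edge {x = elem f zero} {elem g zero} {elem g′ zero} {elem f (suc zero)}
      (chain f z≤n) (below {g} s) (below {g′} s′) (dim-elem f zero) (dim-elem g zero) (dim-elem g′ zero)
      (dim-elem f (suc zero)) (proj₁ (s zero) eq) (proj₁ (s′ zero) eq)
      where
      below : ∀ {h} → σ k f h → elem h zero ⊑ elem f (suc zero)
      below {h} t = ⊑-respʳ {F = elem h zero} (agree {h} t λ eq′ → case trans eq (sym eq′) of λ ()) (chain h z≤n)
    changed i@(suc i′) eq with upper i eq
    ... | U , dU , fU , gU , g′U =
      diamond {L = elem f j} {elem f i} {elem g i} {elem g′ i} {U}
        (chain f j≤i) (above {g} s) (above {g′} s′)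
        (trans (dim-elem f i) (cong suc (sym (trans (dim-elem f j) (Fin.toℕ-inject₁ i′)))))
        (dim≡ g i) (dim≡ g′ i) fU gU g′U dU (proj₁ (s i) eq) (proj₁ (s′ i) eq)
      where
      j = inject₁ i′
      j≤i : toℕ j ≤ toℕ i
      j≤i = subst (_≤ toℕ i) (sym (Fin.toℕ-inject₁ i′)) (ℕ.n≤1+n _)
      above : ∀ {h} → σ k f h → elem f j ⊑ elem h i
      above {h} t = ⊑-respˡ {G = elem h i}
        (agree {h} t λ eq′ → ℕ.1+n≢n (sym (trans (sym (Fin.toℕ-inject₁ i′)) (ℕ.suc-injective (trans eq′ (sym eq))))))
        (chain h j≤i)

  σ-upTo-unique : ∀ k {f f′ g g′ : Flag (2+ n)} → f ≈ᶠ f′ → σ-upTo k f g → σ-upTo k f′ g′ → g ≈ᶠ g′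
  σ-upTo-unique zero p s s′ i = ≈-trans (≈-sym (s i)) (≈-trans (p i) (s′ i))
  σ-upTo-unique (suc k) {f} {f′} {g} {g′} p (h , s , t) (h′ , s′ , t′) =
    σ-unique (suc k) {h} {h′} {g} {g′} (σ-upTo-unique k {f} {f′} {h} {h′} p s s′) t t′

  T-unique : ∀ {f f′ g g′ : Flag (2+ n)} → f ≈ᶠ f′ → T f g → T f′ g′ → g ≈ᶠ g′
  T-unique {f} {f′} {g} {g′} = σ-upTo-unique (2+ n) {f} {f′} {g} {g′}

  -- Induction on the column `j`, then on `i`: the entry at (i , j+1) lies between the entries at
  -- (i-1 , j+1) and (i+1 , j) and differs from the one at (i , j), which also lies there. For i = 0
  -- the edge at (1 , j) takes over.
  Triangle-unique : ∀ {f f′ : Flag (2+ n)} (t : Triangle f) (t′ : Triangle f′) → f ≈ᶠ f′ →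
                    ∀ j i → i + j < 2+ n → Triangle.x t i j ≈ Triangle.x t′ i j
  Triangle-unique {f} {f′} t t′ p zero i i<d = ≈-trans (subst (λ m → Triangle.x t m 0 ≈ elem f k) toℕ-k (Triangle.first t k))
      (≈-trans (p k) (≈-sym (subst (λ m → Triangle.x t′ m 0 ≈ elem f′ k) toℕ-k (Triangle.first t′ k))))
    where
    i<d′ : i < 2+ n
    i<d′ = subst (_< (2+ n)) (ℕ.+-identityʳ i) i<d
    k = fromℕ< i<d′
    toℕ-k : toℕ k ≡ i
    toℕ-k = Fin.toℕ-fromℕ< i<d′
  Triangle-unique t t′ p (suc j) zero 1+j<d =
    edge {x = t.x 0 j} {t.x 0 (suc j)} {t′.x 0 (suc j)} {t.x 1 j}
      (t.up 1+j<d) (t.cross 1+j<d) (⊑-respʳ {F = t′.x 0 (suc j)} (≈-sym (IH 1 1+j<d)) (t′.cross 1+j<d))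
      (t.dim-x j<d) (t.dim-x 1+j<d) (t′.dim-x 1+j<d) (t.dim-x 1+j<d)
      (t.change 1+j<d) (λ e → t′.change 1+j<d (≈-trans e (IH 0 j<d)))
    where
    module t = Triangle t
    module t′ = Triangle t′
    IH = Triangle-unique t t′ p j
    j<d : j < 2+ n
    j<d = ℕ.<-trans (ℕ.n<1+n j) 1+j<d
  Triangle-unique t t′ p (suc j) i@(suc i′) lt =
    diamond {L = t.x i′ (suc j)} {t.x i j} {t.x i (suc j)} {t′.x i (suc j)} {t.x (suc i) j}
      (t.cross lt′) (t.up lt) (⊑-respˡ {G = t′.x i (suc j)} (≈-sym (Triangle-unique t t′ p (suc j) i′ lt′)) (t′.up lt))
      (trans (t.dim-x lt₁) (cong suc (sym (t.dim-x lt′))))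
      (trans (t.dim-x lt) (sym (t.dim-x lt₁))) (trans (t′.dim-x lt) (sym (t.dim-x lt₁)))
      (⊑⇒≲ {F = t.x i j} {t.x (suc i) j} (t.up lt₂))
      (⊑⇒≲ {F = t.x i (suc j)} {t.x (suc i) j} (t.cross lt))
      (⊑⇒≲ {F = t′.x i (suc j)} {t.x (suc i) j} (⊑-respʳ {F = t′.x i (suc j)} (≈-sym (IH (suc i) lt₂)) (t′.cross lt)))
      (trans (t.dim-x lt₂) (cong suc (sym (t.dim-x lt₁))))
      (t.change lt) (λ e → t′.change lt (≈-trans e (IH i lt₁)))
    where
    module t = Triangle t
    module t′ = Triangle t′
    IH = Triangle-unique t t′ p j
    lt₂ : suc i + j < 2+ n
    lt₂ = subst (_< (2+ n)) (ℕ.+-suc i j) lt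
    lt₁ : i + j < 2+ n
    lt₁ = ℕ.<-trans (ℕ.n<1+n _) lt₂
    lt′ : i′ + suc j < 2+ n
    lt′ = ℕ.<-trans (ℕ.n<1+n _) lt

  IsReverse-unique : ∀ {f f′ g g′ : Flag (2+ n)} → f ≈ᶠ f′ → IsReverse f g → IsReverse f′ g′ → g ≈ᶠ g′
  IsReverse-unique {f} {f′} p (t , eq) (t′ , eq′) i = ≈-trans (eq i)
    (≈-trans (Triangle-unique {f} {f′} t t′ p (toℕ (opposite i)) (toℕ i) (ℕ.≤-reflexive (toℕ-opposite i))) (≈-sym (eq′ i)))

  IsReverse-resp : ∀ {f f′ g g′ : Flag (2+ n)} → f ≈ᶠ f′ → g ≈ᶠ g′ → IsReverse f g → IsReverse f′ g′
  IsReverse-resp p q (t , eq) = t′ , λ i → ≈-trans (≈-sym (q i)) (eq i)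
    where
    t′ = record
      { x = Triangle.x t ; first = λ i → ≈-trans (Triangle.first t i) (p i)
      ; dim-x = Triangle.dim-x t ; up = Triangle.up t ; cross = Triangle.cross t ; change = Triangle.change t }

-- Cyclic positions

module _ {n : ℕ} .{{_ : NonZero n}} where

  toℕ-mod : ∀ m → toℕ (m mod n) ≡ m % n
  toℕ-mod m = Fin.toℕ-fromℕ< (m%n<n m n)

  mod-cong : ∀ {l m} → l % n ≡ m % n → l mod n ≡ m mod n
  mod-cong {l} {m} eq = Fin.toℕ-injective (trans (toℕ-mod l) (trans eq (sym (toℕ-mod m))))

  mod-injective : ∀ {l m} → l mod n ≡ m mod n → l % n ≡ m % n
  mod-injective {l} {m} eq = trans (sym (toℕ-mod l)) (trans (cong toℕ eq) (toℕ-mod m))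

  toℕ-mod-Fin : ∀ (i : Fin n) → toℕ i mod n ≡ i
  toℕ-mod-Fin i = Fin.toℕ-injective (trans (toℕ-mod (toℕ i)) (m<n⇒m%n≡m (Fin.toℕ<n i)))

  suc-% : ∀ m → suc (m % n) % n ≡ suc m % n
  suc-% m = trans (%-distribˡ-+ 1 (m % n) n)
    (trans (cong (λ r → (1 % n + r) % n) (m%n%n≡m%n m n)) (sym (%-distribˡ-+ 1 m n)))

next : Fin (suc n) → Fin (suc n)
next i with view i
... | ‵fromℕ     = zero
... | ‵inject₁ j = suc j

previous : Fin (suc n) → Fin (suc n)
previous {n} zero    = fromℕ n
previous     (suc i) = inject₁ i

next-fromℕ : ∀ n → next (fromℕ n) ≡ zero
next-fromℕ n rewrite view-fromℕ n = refl

next-inject₁ : ∀ (i : Fin n) → next (inject₁ i) ≡ suc i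
next-inject₁ i rewrite view-inject₁ i = refl

next-previous : ∀ (i : Fin (suc n)) → next (previous i) ≡ i
next-previous zero    = next-fromℕ _
next-previous (suc i) = next-inject₁ i

previous-next : ∀ (i : Fin (suc n)) → previous (next i) ≡ i
previous-next i with view i
... | ‵fromℕ     = refl
... | ‵inject₁ j = refl

rotate : Permutation′ (suc n)
rotate = permutation next previous next-previous previous-next

toℕ-next : ∀ (i : Fin (suc n)) → toℕ (next i) ≡ suc (toℕ i) % suc n
toℕ-next {n} i with view i
... | ‵fromℕ     = sym (trans (cong (λ m → suc m % suc n) (Fin.toℕ-fromℕ n)) (n%n≡0 (suc n)))
... | ‵inject₁ j = sym (trans (cong (λ m → suc m % suc n) (Fin.toℕ-inject₁ j)) (m<n⇒m%n≡m (s<s (Fin.toℕ<n j))))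

next-mod : ∀ m → next (m mod suc n) ≡ suc m mod suc n
next-mod {n} m = Fin.toℕ-injective (trans (toℕ-next (m mod suc n))
  (trans (cong (λ r → suc r % suc n) (toℕ-mod {suc n} m)) (trans (suc-% {suc n} m) (sym (toℕ-mod {suc n} (suc m))))))

-- The dihedral relation: a reflection composed with the rotation is an involution.
next-opposite : ∀ (i : Fin (suc n)) → next (opposite (next (opposite i))) ≡ i
next-opposite zero    = trans (cong (next ∘ opposite) (next-fromℕ _)) (next-fromℕ _)
next-opposite (suc i) = trans (cong (next ∘ opposite) (next-inject₁ (opposite i)))
  (trans (cong (next ∘ inject₁) (Fin.opposite-involutive i)) (next-inject₁ i))

-- Codes: the flag whose vertex is  sgn  and whose (i+1)-st element arises from the
-- i-th by freeing the coordinate  perm ⟨$⟩ʳ i .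

record Code (d : ℕ) : Set where
  constructor code
  field
    sgn  : Vec Sign d
    perm : Permutation′ d

open Code public

infix 4 _≅ˢ_ _≅_
infixr 4 _,_

_≅ˢ_ : Vec Sign d → Vec Sign d → Set
u ≅ˢ v = u ≡ v ⊎ u ≡ map flip v

record _≅_ (c c′ : Code d) : Set where
  constructor _,_
  field
    signs : sgn c ≅ˢ sgn c′
    perms : perm c Perm.≈ perm c′

open _≅_ public

map-flip-involutive : ∀ (v : Vec Sign d) → map flip (map flip v) ≡ v
map-flip-involutive v = trans (sym (Vec.map-∘ flip flip v)) (trans (Vec.map-cong Sign.opposite-involutive v) (Vec.map-id v))

≅-refl : ∀ {c : Code d} → c ≅ c
≅-refl = inj₁ refl , λ _ → refl

≅-sym : ∀ {c c′ : Code d} → c ≅ c′ → c′ ≅ c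
≅-sym (inj₁ p , q) = inj₁ (sym p) , sym ∘ q
≅-sym {c′ = c′} (inj₂ p , q) = inj₂ (sym (trans (cong (map flip) p) (map-flip-involutive (sgn c′)))) , sym ∘ q

≅-trans : ∀ {c c′ c″ : Code d} → c ≅ c′ → c′ ≅ c″ → c ≅ c″
≅-trans {c = c} {c′} {c″} (p , q) (p′ , q′) = compose p p′ , λ i → trans (q i) (q′ i)
  where
  compose : sgn c ≅ˢ sgn c′ → sgn c′ ≅ˢ sgn c″ → sgn c ≅ˢ sgn c″
  compose (inj₁ p) (inj₁ p′) = inj₁ (trans p p′)
  compose (inj₁ p) (inj₂ p′) = inj₂ (trans p p′)
  compose (inj₂ p) (inj₁ p′) = inj₂ (trans p (cong (map flip) p′))
  compose (inj₂ p) (inj₂ p′) = inj₁ (trans p (trans (cong (map flip) p′) (map-flip-involutive (sgn c″))))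

-- Separating two classes takes two witnesses: a changed sign excludes equality, a kept sign
-- excludes negation.
flips-mixed : ∀ {u v : Vec Sign d} k l → lookup u k ≡ flip (lookup v k) → lookup u l ≡ lookup v l → ¬ (u ≅ˢ v)
flips-mixed {v = v} k l eqₖ eqₗ (inj₁ refl) = Sign.s≢opposite[s] (lookup v k) eqₖ
flips-mixed {v = v} k l eqₖ eqₗ (inj₂ refl) =
  Sign.s≢opposite[s] (lookup v l) (trans (sym eqₗ) (Vec.lookup-map l flip v))

flips-one : ∀ (v : Vec Sign (2+ n)) k → ¬ (v [ k ]%= flip ≅ˢ v)
flips-one v k = flips-mixed k (punchIn k zero) (Vec.lookup∘updateAt k v)
  (Vec.lookup∘updateAt′ (punchIn k zero) k (Fin.punchInᵢ≢i k zero) v)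

map-flip-updateAt : ∀ (v : Vec Sign d) k → map flip (v [ k ]%= flip) ≡ map flip v [ k ]%= flip
map-flip-updateAt v k = Vec.map-updateAt v k refl

flipAt : Fin d → Code d → Code d
flipAt k c = record c { sgn = sgn c [ k ]%= flip }

-- Keeps the vertex, so it is not the reverse of the flag itself; that is `op` after d - 1 shifts.
-- Both lie on the same zigzag.
op : Code d → Code d
op c = record c { perm = reverse ∘ₚ perm c }

flipAt-cong : ∀ k {c c′ : Code d} → c ≅ c′ → flipAt k c ≅ flipAt k c′
flipAt-cong k (inj₁ p , q) = inj₁ (cong (_[ k ]%= flip) p) , q
flipAt-cong k {c′ = c′} (inj₂ p , q) =
  inj₂ (trans (cong (_[ k ]%= flip) p) (sym (map-flip-updateAt (sgn c′) k))) , q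

flipAt-comm : ∀ k l (c : Code d) → flipAt k (flipAt l c) ≅ flipAt l (flipAt k c)
flipAt-comm k l c with k Fin.≟ l
... | yes refl = ≅-refl
... | no  k≢l  = inj₁ (Vec.updateAt-commutes k l k≢l (sgn c)) , λ _ → refl

op-cong : ∀ {c c′ : Code d} → c ≅ c′ → op c ≅ op c′
op-cong (p , q) = p , q ∘ opposite

op-involutive : ∀ (c : Code d) → op (op c) ≅ c
op-involutive c = inj₁ refl , λ i → cong (perm c ⟨$⟩ʳ_) (Fin.opposite-involutive i)

-- The shift on codes, its period, and its interplay with reversal

module _ {n : ℕ} where

  -- Positions are naturals read modulo d, so that shifting a code becomes addition.
  axis : Code (suc n) → ℕ → Fin (suc n)
  axis c m = perm c ⟨$⟩ʳ (m mod suc n)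

  rank : Code (suc n) → Fin (suc n) → ℕ
  rank c k = toℕ (perm c ⟨$⟩ˡ k)

  axis-rank : ∀ c k → axis c (rank c k) ≡ k
  axis-rank c k = trans (cong (perm c ⟨$⟩ʳ_) (toℕ-mod-Fin (perm c ⟨$⟩ˡ k))) (Perm.inverseʳ (perm c))

  rank-axis : ∀ c {m} → m < suc n → rank c (axis c m) ≡ m
  rank-axis c {m} m<d = trans (cong toℕ (Perm.inverseˡ (perm c))) (trans (toℕ-mod m) (m<n⇒m%n≡m m<d))

  axis-injective : ∀ c {l m} → axis c l ≡ axis c m → l % suc n ≡ m % suc n
  axis-injective c {l} {m} eq = mod-injective {l = l} {m}
    (trans (sym (Perm.inverseˡ (perm c))) (trans (cong (perm c ⟨$⟩ˡ_) eq) (Perm.inverseˡ (perm c))))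

  shift : Code (suc n) → Code (suc n)
  shift c = code (sgn c [ axis c 0 ]%= flip) (rotate ∘ₚ perm c)

  shift^ : ℕ → Code (suc n) → Code (suc n)
  shift^ zero    c = c
  shift^ (suc m) c = shift (shift^ m c)

  axis-shift : ∀ c m → axis (shift c) m ≡ axis c (suc m)
  axis-shift c m = cong (perm c ⟨$⟩ʳ_) (next-mod m)

  axis-shift^ : ∀ l c m → axis (shift^ l c) m ≡ axis c (l + m)
  axis-shift^ zero    c m = refl
  axis-shift^ (suc l) c m = trans (axis-shift (shift^ l c) m)
    (trans (axis-shift^ l c (suc m)) (cong (axis c) (ℕ.+-suc l m)))

  shift^-+ : ∀ l m c → shift^ (l + m) c ≡ shift^ l (shift^ m c)
  shift^-+ zero    m c = refl
  shift^-+ (suc l) m c = cong shift (shift^-+ l m c)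

  axis⇒perm : ∀ {c c′ : Code (suc n)} → (∀ m → axis c m ≡ axis c′ m) → perm c Perm.≈ perm c′
  axis⇒perm {c} {c′} eq i = trans (cong (perm c ⟨$⟩ʳ_) (sym (toℕ-mod-Fin i)))
    (trans (eq (toℕ i)) (cong (perm c′ ⟨$⟩ʳ_) (toℕ-mod-Fin i)))

  shift-cong : ∀ {c c′ : Code (suc n)} → c ≅ c′ → shift c ≅ shift c′
  shift-cong {c} {c′} (p , q) with flipAt-cong (axis c 0) {c} {c′} (p , q)
  ... | p′ , _ = subst (λ k → sgn c [ axis c 0 ]%= flip ≅ˢ sgn c′ [ k ]%= flip) (q (0 mod suc n)) p′ , q ∘ next

  shift^-cong : ∀ m {c c′ : Code (suc n)} → c ≅ c′ → shift^ m c ≅ shift^ m c′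
  shift^-cong zero    p = p
  shift^-cong (suc m) p = shift-cong (shift^-cong m p)

  shift-flipAt : ∀ k (c : Code (suc n)) → shift (flipAt k c) ≅ flipAt k (shift c)
  shift-flipAt k c = signs (flipAt-comm (axis c 0) k c) , λ _ → refl

  shift^-flipAt : ∀ m k (c : Code (suc n)) → shift^ m (flipAt k c) ≅ flipAt k (shift^ m c)
  shift^-flipAt zero    k c = ≅-refl
  shift^-flipAt (suc m) k c = ≅-trans (shift-cong (shift^-flipAt m k c)) (shift-flipAt k (shift^ m c))

  axis-op : ∀ c → axis (op (shift c)) 0 ≡ axis c 0
  axis-op c = cong (perm c ⟨$⟩ʳ_) (next-fromℕ n)

  sgn-shift-op-shift : ∀ c → sgn (shift (op (shift c))) ≡ sgn c
  sgn-shift-op-shift c = trans (cong (λ k → sgn c [ axis c 0 ]%= flip [ k ]%= flip) (axis-op c))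
    (trans (Vec.updateAt-updateAt (axis c 0) (sgn c))
      (Vec.updateAt-id-local (axis c 0) (sgn c) (Sign.opposite-involutive _)))

  perm-shift-op-shift : ∀ c → perm (shift (op (shift c))) Perm.≈ perm (op c)
  perm-shift-op-shift c i = cong (perm c ⟨$⟩ʳ_)
    (trans (cong (next ∘ opposite ∘ next) (sym (Fin.opposite-involutive i))) (next-opposite (opposite i)))

  -- The first shift flips the leading coordinate and moves it to the end, `op` brings it back to
  -- the front, and the second shift flips it back.
  shift-op-shift : ∀ c → shift (op (shift c)) ≅ op c
  shift-op-shift c = inj₁ (sgn-shift-op-shift c) , perm-shift-op-shift c

  -- Hence the images under `op` of all members of one orbit lie in one orbit: the reverse of a
  -- zigzag does not depend on the starting flag.
  shift^-op-shift^ : ∀ m c → shift^ m (op (shift^ m c)) ≅ op c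
  shift^-op-shift^ zero    c = ≅-refl
  shift^-op-shift^ (suc m) c =
    ≅-trans (subst (λ x → x ≅ shift^ m (shift c′)) eq ≅-refl)
      (≅-trans (shift^-cong m (shift-op-shift (shift^ m c))) (shift^-op-shift^ m c))
    where
    c′ = op (shift (shift^ m c))
    eq : shift^ m (shift c′) ≡ shift (shift^ m c′)
    eq = trans (sym (shift^-+ m 1 c′)) (cong (λ l → shift^ l c′) (ℕ.+-comm m 1))

  sgn-shift^-≤ : ∀ m c k → m ≤ rank c k → lookup (sgn (shift^ m c)) k ≡ lookup (sgn c) k
  sgn-shift^-≤ zero    c k le = refl
  sgn-shift^-≤ (suc m) c k lt = trans
    (Vec.lookup∘updateAt′ k (axis (shift^ m c) 0) k≢ (sgn (shift^ m c)))
    (sgn-shift^-≤ m c k (ℕ.<⇒≤ lt))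
    where
    k≢ : k ≢ axis (shift^ m c) 0
    k≢ eq = ℕ.<⇒≢ lt (sym (trans (cong (rank c) (trans eq (trans (axis-shift^ m c 0) (cong (axis c) (ℕ.+-identityʳ m)))))
      (rank-axis c (ℕ.<-trans lt (Fin.toℕ<n (perm c ⟨$⟩ˡ k))))))

  -- In the first round each axis is flipped once, in the order of rank. The bound on `m` stops at
  -- the end of that round, as a further shift would flip axis 0 back.
  sgn-shift^-> : ∀ m c k → rank c k < m → m ≤ suc n → lookup (sgn (shift^ m c)) k ≡ flip (lookup (sgn c) k)
  sgn-shift^-> (suc m) c k lt m<d with rank c k ℕ.≟ m
  ... | yes eq = trans (cong (λ l → lookup (sgn (shift^ m c) [ l ]%= flip) k) axis≡)
        (trans (Vec.lookup∘updateAt k (sgn (shift^ m c)))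
          (cong flip (sgn-shift^-≤ m c k (ℕ.≤-reflexive (sym eq)))))
    where
    axis≡ : axis (shift^ m c) 0 ≡ k
    axis≡ = trans (axis-shift^ m c 0)
      (trans (cong (axis c) (trans (ℕ.+-identityʳ m) (sym eq))) (axis-rank c k))
  ... | no neq = trans (Vec.lookup∘updateAt′ k (axis (shift^ m c) 0) k≢ (sgn (shift^ m c)))
        (sgn-shift^-> m c k (ℕ.≤∧≢⇒< (ℕ.≤-pred lt) neq) (ℕ.<⇒≤ m<d))
    where
    k≢ : k ≢ axis (shift^ m c) 0
    k≢ eq = neq (trans (cong (rank c) (trans eq (trans (axis-shift^ m c 0) (cong (axis c) (ℕ.+-identityʳ m)))))
      (rank-axis c m<d))

  shift^-period : ∀ c → shift^ (suc n) c ≅ c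
  shift^-period c =
    inj₂ (lookup-injective λ k → trans (sgn-shift^-> (suc n) c k (Fin.toℕ<n _) ℕ.≤-refl) (sym (Vec.lookup-map k flip (sgn c)))) ,
    axis⇒perm {shift^ (suc n) c} {c} λ m → trans (axis-shift^ (suc n) c m)
      (cong (perm c ⟨$⟩ʳ_) (mod-cong {l = suc n + m} {m} (trans (cong (_% suc n) (ℕ.+-comm (suc n) m)) ([m+n]%n≡m%n m (suc n)))))

  shift^-periods : ∀ q c → shift^ (q * suc n) c ≅ c
  shift^-periods zero    c = ≅-refl
  shift^-periods (suc q) c = subst (_≅ c) (sym (shift^-+ (suc n) (q * suc n) c))
    (≅-trans (shift^-period _) (shift^-periods q c))

  -- Faces and flags of codes

  face : Code (suc n) → ℕ → Face (suc n)
  face c zero    = map just (sgn c)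
  face c (suc m) = face c m [ axis c m ]≔ nothing

  face-cong : ∀ {c c′ : Code (suc n)} → sgn c ≡ sgn c′ → perm c Perm.≈ perm c′ → ∀ m → face c m ≡ face c′ m
  face-cong p q zero    = cong (map just) p
  face-cong p q (suc m) = cong₂ (λ F k → F [ k ]≔ nothing) (face-cong p q m) (q (m mod suc n))

  face-neg : ∀ {c c′ : Code (suc n)} → sgn c ≡ map flip (sgn c′) → perm c Perm.≈ perm c′ →
             ∀ m → face c m ≡ neg (face c′ m)
  face-neg {c} {c′} p q zero = trans (cong (map just) p)
    (trans (sym (Vec.map-∘ just flip (sgn c′))) (Vec.map-∘ (Maybe.map flip) just (sgn c′)))
  face-neg {c} {c′} p q (suc m) = trans
    (cong₂ (λ F k → F [ k ]≔ nothing) (face-neg {c} {c′} p q m) (q (m mod suc n)))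
    (sym (Vec.map-[]≔ (Maybe.map flip) (face c′ m) (axis c′ m)))

  face-resp : ∀ {c c′ : Code (suc n)} → c ≅ c′ → ∀ m → face c m ≈ face c′ m
  face-resp (inj₁ p , q) m = inj₁ (face-cong p q m)
  face-resp {c} {c′} (inj₂ p , q) m = inj₂ (face-neg {c} {c′} p q m)

  face-free : ∀ c m k → rank c k < m → lookup (face c m) k ≡ nothing
  face-free c (suc m) k lt with k Fin.≟ axis c m
  ... | yes refl = lookup-free (face c m) k
  ... | no  k≢   = trans (Vec.lookup∘update′ k≢ (face c m) nothing)
    (face-free c m k (ℕ.≤∧≢⇒< (ℕ.≤-pred lt) λ { refl → k≢ (sym (axis-rank c k)) }))

  face-fixed : ∀ c m k → m ≤ rank c k → lookup (face c m) k ≡ just (lookup (sgn c) k)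
  face-fixed c zero    k le = Vec.lookup-map k just (sgn c)
  face-fixed c (suc m) k lt = trans (Vec.lookup∘update′ k≢ (face c m) nothing) (face-fixed c m k (ℕ.<⇒≤ lt))
    where
    k≢ : k ≢ axis c m
    k≢ refl = ℕ.<⇒≢ lt (sym (rank-axis c (ℕ.<-trans lt (Fin.toℕ<n _))))

  face-free⁻¹ : ∀ c m k → lookup (face c m) k ≡ nothing → rank c k < m
  face-free⁻¹ c m k eq with rank c k ℕ.<? m
  ... | yes lt = lt
  ... | no  ge = case trans (sym eq) (face-fixed c m k (ℕ.≮⇒≥ ge)) of λ ()

  dim-face : ∀ c m → m ≤ suc n → dim (face c m) ≡ m
  dim-face c zero    _   = dim-vertex (sgn c)
    where
    dim-vertex : ∀ {d} (v : Vec Sign d) → dim (map just v) ≡ 0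
    dim-vertex []      = refl
    dim-vertex (_ ∷ v) = dim-vertex v
  dim-face c (suc m) m<d = trans
    (dim-free (face c m) (axis c m) (face-fixed c m (axis c m) (ℕ.≤-reflexive (sym (rank-axis c m<d)))))
    (cong suc (dim-face c m (ℕ.<⇒≤ m<d)))

  face-mono : ∀ c {l m} → l ≤ m → face c l ⊆ face c m
  face-mono c {l} {m} l≤m = subst (λ m → face c l ⊆ face c m) (ℕ.m∸n+n≡m l≤m) (go (m ∸ l))
    where
    go : ∀ e → face c l ⊆ face c (e + l)
    go zero    = ⊆-refl {F = face c l}
    go (suc e) = ⊆-trans {F = face c l} {face c (e + l)} {face c (suc e + l)} (go e)
      (⊆-free (face c (e + l)) (axis c (e + l)))

  free-comm : ∀ (F : Face (suc n)) k l → F [ k ]≔ nothing [ l ]≔ nothing ≡ F [ l ]≔ nothing [ k ]≔ nothing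
  free-comm F k l with k Fin.≟ l
  ... | yes refl = refl
  ... | no  k≢l  = Vec.[]≔-commutes F k l k≢l

  face-flipAt : ∀ c k m → face (flipAt k c) m [ k ]≔ nothing ≡ face c m [ k ]≔ nothing
  face-flipAt c k zero = trans
    (cong (_[ k ]≔ nothing) (Vec.map-updateAt {f = just} {h = Maybe.map flip} (sgn c) k refl))
    (Vec.updateAt-updateAt k (map just (sgn c)))
  face-flipAt c k (suc m) = trans (free-comm _ (axis c m) k)
    (trans (cong (_[ axis c m ]≔ nothing) (face-flipAt c k m)) (free-comm _ k (axis c m)))

  face-flip-axis₀ : ∀ c m → face (flipAt (axis c 0) c) (suc m) ≡ face c (suc m)
  face-flip-axis₀ c zero    = face-flipAt c (axis c 0) 0
  face-flip-axis₀ c (suc m) = cong (_[ axis c (suc m) ]≔ nothing) (face-flip-axis₀ c m)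

  -- Both sides free the axes 0, ..., m, and the only sign changed by `shift` sits on axis 0, where
  -- it is forgotten. Thus face m of the shifted flag lies below face m + 1 of the old one.
  face-shift : ∀ c m → face (shift c) m [ axis c 0 ]≔ nothing ≡ face c (suc m)
  face-shift c zero    = face-flipAt c (axis c 0) 0
  face-shift c (suc m) = trans (free-comm _ (axis (shift c) m) (axis c 0))
    (cong₂ (λ F k → F [ k ]≔ nothing) (face-shift c m) (axis-shift c m))

  face-shift-⊆ : ∀ c m → face (shift c) m ⊆ face c (suc m)
  face-shift-⊆ c m = subst (face (shift c) m ⊆_) (face-shift c m) (⊆-free (face (shift c) m) (axis c 0))

  -- After m shifts the axes 0, ..., m - 1 stand in the last m places, and `op` moves them to the
  -- front. The signs have changed on these axes only, and these are the ones freed.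
  face-op-shift^ : ∀ m c → face (op (shift^ m c)) m ≡ face c m
  face-op-shift^ zero    c = refl
  face-op-shift^ (suc m) c = trans (sym (face-shift (op (shift (shift^ m c))) m))
    (cong₂ (λ F k → F [ k ]≔ nothing)
      (trans (face-cong (sgn-shift-op-shift (shift^ m c)) (perm-shift-op-shift (shift^ m c)) m)
        (face-op-shift^ m c))
      (trans (axis-op (shift^ m c)) (trans (axis-shift^ m c 0) (cong (axis c) (ℕ.+-identityʳ m)))))

  flagOf : Code (suc n) → Flag (suc n)
  flagOf c = record
    { elem     = λ i → face c (toℕ i)
    ; dim-elem = λ i → dim-face c (toℕ i) (ℕ.<⇒≤ (Fin.toℕ<n i))
    ; chain    = λ i≤j → inj₁ (face-mono c i≤j)
    }

  flagOf-cong : ∀ {c c′ : Code (suc n)} → c ≅ c′ → flagOf c ≈ᶠ flagOf c′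
  flagOf-cong p i = face-resp p (toℕ i)

  map-just-injective : ∀ {u v : Vec Sign d} → map just u ≡ map just v → u ≡ v
  map-just-injective {u = u} {v} eq = lookup-injective λ k → just-injective
    (trans (sym (Vec.lookup-map k just u)) (trans (cong (λ w → lookup w k) eq) (Vec.lookup-map k just v)))

  vertex-injective : ∀ {u v : Vec Sign d} → map just u ≈ map just v → u ≅ˢ v
  vertex-injective (inj₁ p) = inj₁ (map-just-injective p)
  vertex-injective {u = u} {v} (inj₂ p) = inj₂ (map-just-injective (trans p
    (trans (sym (Vec.map-∘ (Maybe.map flip) just v)) (Vec.map-∘ just flip v))))

  -- The bottom element gives the signs up to negation. The rank of a coordinate is the index of the
  -- last element that still fixes it, and being free does not depend on representatives.
  flagOf-injective : ∀ {c c′ : Code (suc n)} → flagOf c ≈ᶠ flagOf c′ → c ≅ c′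
  flagOf-injective {c} {c′} p = vertex-injective (p zero) , perm≡
    where
    perm≡ : ∀ i → perm c ⟨$⟩ʳ i ≡ perm c′ ⟨$⟩ʳ i
    perm≡ i = sym (trans (cong (perm c′ ⟨$⟩ʳ_) (Fin.toℕ-injective (ℕ.≤-antisym upper lower))) (Perm.inverseʳ (perm c′)))
      where
      k = perm c ⟨$⟩ʳ i
      rank≡ : rank c k ≡ toℕ i
      rank≡ = cong toℕ (Perm.inverseˡ (perm c))
      upper : toℕ i ≤ rank c′ k
      upper with rank c′ k ℕ.<? toℕ i
      ... | no  ge = ℕ.≮⇒≥ ge
      ... | yes lt = contradiction
        (face-free⁻¹ c (toℕ i) k (≈⇒≲ (≈-sym (p i)) k (face-free c′ (toℕ i) k lt)))
        (ℕ.≤⇒≯ (ℕ.≤-reflexive (sym rank≡)))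
      lower : rank c′ k ≤ toℕ i
      lower with suc (toℕ i) ℕ.<? suc n
      -- At the last position there is no next element to compare, but every rank is below d.
      ... | no  ge = ℕ.≤-pred (ℕ.≤-trans (Fin.toℕ<n _) (ℕ.≮⇒≥ ge))
      ... | yes lt = ℕ.≤-pred (face-free⁻¹ c′ (suc (toℕ i)) k
        (subst (λ m → lookup (face c′ m) k ≡ nothing) (Fin.toℕ-fromℕ< lt)
          (≈⇒≲ (p (fromℕ< lt)) k (face-free c _ k
            (subst (rank c k <_) (sym (Fin.toℕ-fromℕ< lt)) (ℕ.≤-reflexive (cong suc rank≡)))))))

-- T, σ₁ and the reverse computed on codes

module _ {n : ℕ} where

  -- Axis 0 tells the two apart: the old flag frees it first, the shifted one last. At m = 0 both
  -- faces are vertices, and flipping one of at least two signs is not a negation.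
  face-shift-≉ : ∀ (c : Code (2+ n)) m → m < 2+ n → ¬ (face (shift c) m ≈ face c m)
  face-shift-≉ c zero m<d eq = flips-one (sgn c) (axis c 0) (vertex-injective {n} eq)
  face-shift-≉ c (suc m) m<d eq = case trans (sym (≈⇒≲ (≈-sym eq) k free)) fixed of λ ()
    where
    k = axis c 0
    free : lookup (face c (suc m)) k ≡ nothing
    free = face-free c (suc m) k (subst (_< suc m) (sym (rank-axis c z<s)) z<s)
    rank≡ : rank (shift c) k ≡ suc n
    rank≡ = trans (cong (rank (shift c)) (sym (trans (axis-shift c (suc n))
      (cong (perm c ⟨$⟩ʳ_) (mod-cong {l = 2+ n} {0} (n%n≡0 (2+ n))))))) (rank-axis (shift c) (ℕ.n<1+n _))
    fixed : lookup (face (shift c) (suc m)) k ≡ just (lookup (sgn (shift c)) k)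
    fixed = face-fixed (shift c) (suc m) k (subst (suc m ≤_) (sym rank≡) (ℕ.≤-pred m<d))

  -- The flags passed on the way from f to T f: the first k elements are already those of T f.
  partialShift : Code (2+ n) → ℕ → Flag (2+ n)
  partialShift c k = record { elem = el ; dim-elem = dim-el ; chain = λ {i} {j} → chain′ {i} {j} }
    where
    el : Fin (2+ n) → Face (2+ n)
    el i with toℕ i ℕ.<? k
    ... | yes _ = face (shift c) (toℕ i)
    ... | no  _ = face c (toℕ i)
    dim-el : ∀ i → dim (el i) ≡ toℕ i
    dim-el i with toℕ i ℕ.<? k
    ... | yes _ = dim-face (shift c) (toℕ i) (ℕ.<⇒≤ (Fin.toℕ<n i))
    ... | no  _ = dim-face c (toℕ i) (ℕ.<⇒≤ (Fin.toℕ<n i))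
    chain′ : ∀ {i j} → toℕ i ≤ toℕ j → el i ⊑ el j
    chain′ {i} {j} i≤j with toℕ i ℕ.<? k | toℕ j ℕ.<? k
    ... | yes _   | yes _   = inj₁ (face-mono (shift c) i≤j)
    ... | yes i<k | no  j≮k = inj₁ (⊆-trans {F = face (shift c) (toℕ i)} {face c (suc (toℕ i))} {face c (toℕ j)}
                                (face-shift-⊆ c (toℕ i)) (face-mono c (ℕ.<-≤-trans i<k (ℕ.≮⇒≥ j≮k))))
    ... | no  i≮k | yes j<k = contradiction (ℕ.≤-<-trans i≤j j<k) i≮k
    ... | no  _   | no  _   = inj₁ (face-mono c i≤j)

  partialShift-< : ∀ c k i → toℕ i < k → elem (partialShift c k) i ≡ face (shift c) (toℕ i)
  partialShift-< c k i lt with toℕ i ℕ.<? k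
  ... | yes _ = refl
  ... | no ge = contradiction lt ge

  partialShift-≥ : ∀ c k i → k ≤ toℕ i → elem (partialShift c k) i ≡ face c (toℕ i)
  partialShift-≥ c k i ge with toℕ i ℕ.<? k
  ... | yes lt = contradiction ge (ℕ.<⇒≱ lt)
  ... | no _   = refl

  partialShift-σ : ∀ c k → σ (suc k) (partialShift c k) (partialShift c (suc k))
  partialShift-σ c k i = (λ eq eq′ → changed (ℕ.suc-injective eq) eq′) , λ neq → kept (neq ∘ cong suc)
    where
    changed : toℕ i ≡ k → ¬ (elem (partialShift c (suc k)) i ≈ elem (partialShift c k) i)
    changed eq = subst₂ (λ F G → ¬ (F ≈ G))
      (sym (partialShift-< c (suc k) i (ℕ.≤-reflexive (cong suc eq))))
      (sym (partialShift-≥ c k i (ℕ.≤-reflexive (sym eq))))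
      (face-shift-≉ c (toℕ i) (Fin.toℕ<n i))
    kept : toℕ i ≢ k → elem (partialShift c (suc k)) i ≈ elem (partialShift c k) i
    kept neq with toℕ i ℕ.<? k
    ... | yes lt = inj₁ (partialShift-< c (suc k) i (ℕ.m<n⇒m<1+n lt))
    ... | no  ge = inj₁ (partialShift-≥ c (suc k) i (ℕ.≤∧≢⇒< (ℕ.≮⇒≥ ge) (neq ∘ sym)))

  partialShift-σ-upTo : ∀ c k → σ-upTo k (flagOf c) (partialShift c k)
  partialShift-σ-upTo c zero    i = inj₁ (sym (partialShift-≥ c 0 i z≤n))
  partialShift-σ-upTo c (suc k) = partialShift c k , partialShift-σ-upTo c k , partialShift-σ c k

  T-flagOf : ∀ (c : Code (2+ n)) → T (flagOf c) (flagOf (shift c))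
  T-flagOf c = σ-upTo-resp (2+ n) {flagOf c} {flagOf c} {partialShift c (2+ n)} {flagOf (shift c)}
    (≈ᶠ-refl {f = flagOf c}) (λ i → inj₁ (partialShift-< c (2+ n) i (Fin.toℕ<n i))) (partialShift-σ-upTo c (2+ n))

  σ₁-flagOf : ∀ (c : Code (2+ n)) → σ 1 (flagOf c) (flagOf (flipAt (axis c 0) c))
  σ₁-flagOf c zero    = (λ _ eq → flips-one (sgn c) (axis c 0) (vertex-injective {n} eq)) , λ neq → contradiction refl neq
  σ₁-flagOf c (suc i) = (λ ()) , λ _ → inj₁ (face-flip-axis₀ c (toℕ i))

  -- Column j of the triangle is the flag of `shift^ j c`. On the antidiagonal i + j = d - 1, so d -
  -- 1 shifts of `c` are i shifts of `shift^ j c`, and `face-op-shift^` recovers its face i from the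
  -- reversed order.
  IsReverse-flagOf : ∀ (c : Code (2+ n)) → IsReverse (flagOf c) (flagOf (op (shift^ (suc n) c)))
  IsReverse-flagOf c = triangle , λ i → inj₁ (trans
      (cong (λ m → face (op (shift^ m c)) (toℕ i)) (sym (ℕ.suc-injective (toℕ-opposite i))))
      (trans (cong (λ c′ → face (op c′) (toℕ i)) (shift^-+ (toℕ i) (toℕ (opposite i)) c))
        (face-op-shift^ (toℕ i) (shift^ (toℕ (opposite i)) c))))
    where
    triangle : Triangle (flagOf c)
    triangle = record
      { x      = λ i j → face (shift^ j c) i
      ; first  = λ i → inj₁ refl
      ; dim-x  = λ {i} {j} lt → dim-face (shift^ j c) i (ℕ.<⇒≤ (ℕ.≤-<-trans (ℕ.m≤m+n i j) lt))
      ; up     = λ {i} {j} _ → inj₁ (face-mono (shift^ j c) (ℕ.n≤1+n i))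
      ; cross  = λ {i} {j} _ → inj₁ (face-shift-⊆ (shift^ j c) i)
      ; change = λ {i} {j} lt → face-shift-≉ (shift^ j c) i (ℕ.≤-<-trans (ℕ.m≤m+n i (suc j)) lt)
      }

-- Every flag has a code

fixed-coordinate : ∀ (F : Face d) → dim F < d → ∃ λ k → ∃ λ s → lookup F k ≡ just s
fixed-coordinate (just s ∷ F)  lt = zero , s , refl
fixed-coordinate (nothing ∷ F) (s≤s lt) with fixed-coordinate F lt
... | k , s , eq = suc k , s , eq

vertex : ∀ (F : Face d) → dim F ≡ 0 → ∃ λ v → F ≡ map just v
vertex []           eq = [] , refl
vertex (just s ∷ F) eq with vertex F eq
... | v , refl = s ∷ v , refl

module _ {n : ℕ} (f : Flag (suc n)) where

  private
    base : Face (suc n)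
    base = elem f zero

    -- Fixes all signs at once: each element is represented by the face that contains the chosen
    -- vertex `base`.
    lift : ∀ i → ∃ λ G → G ≈ elem f i × base ⊆ G
    lift i = ⊑⇒⊆ʳ {F = base} {elem f i} (chain f z≤n)

    rep : Fin (suc n) → Face (suc n)
    rep i = proj₁ (lift i)

    dim-rep : ∀ i → dim (rep i) ≡ toℕ i
    dim-rep i = trans (dim-cong (proj₁ (proj₂ (lift i)))) (dim-elem f i)

    -- The chain condition allows a sign between the representatives. If the negative of `rep i` lay
    -- in `rep j`, then `base` and its negative both would, although the proper face `rep j` fixes
    -- some coordinate.
    rep-⊆ : ∀ i j → toℕ i ≤ toℕ j → rep i ⊆ rep j
    rep-⊆ i j i≤j with ⊑-respˡ {G = rep j} (≈-sym (proj₁ (proj₂ (lift i))))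
                        (⊑-respʳ {F = elem f i} (≈-sym (proj₁ (proj₂ (lift j)))) (chain f i≤j))
    ... | inj₁ p = p
    ... | inj₂ p with fixed-coordinate (rep j) (subst (_< (suc n)) (sym (dim-rep j)) (Fin.toℕ<n j))
    ...   | k , s , eq = contradiction (just-injective
      (trans (sym neg-base≡) (trans (lookup-neg base k) (cong (Maybe.map flip) base≡)))) (Sign.s≢opposite[s] s)
      where
      base≡ : lookup base k ≡ just s
      base≡ = proj₂ (proj₂ (lift j)) k s eq
      neg-base≡ : lookup (neg base) k ≡ just s
      neg-base≡ = neg-⊆ {F = base} {rep i} (proj₂ (proj₂ (lift i))) k s (p k s eq)

    -- The chain is continued by the whole cube at index d, so that it has d covers and each
    -- releases one coordinate.
    G : ℕ → Face (suc n)
    G m with m ℕ.<? (suc n)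
    ... | yes m<d = rep (fromℕ< m<d)
    ... | no  _   = full

    G-toℕ : ∀ i → G (toℕ i) ≡ rep i
    G-toℕ i with toℕ i ℕ.<? (suc n)
    ... | yes m<d = cong rep (Fin.fromℕ<-toℕ i m<d)
    ... | no  m≮d = contradiction (Fin.toℕ<n i) m≮d

    dim-G : ∀ {m} → m ≤ suc n → dim (G m) ≡ m
    dim-G {m} m≤d with m ℕ.<? (suc n)
    ... | yes m<d = trans (dim-rep _) (Fin.toℕ-fromℕ< m<d)
    ... | no  m≮d = trans (dim-full (suc n)) (ℕ.≤-antisym (ℕ.≮⇒≥ m≮d) m≤d)

    G-⊆ : ∀ {l m} → l ≤ m → m ≤ suc n → G l ⊆ G m
    G-⊆ {l} {m} l≤m m≤d with l ℕ.<? (suc n) | m ℕ.<? (suc n)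
    ... | yes l<d | yes m<d = rep-⊆ (fromℕ< l<d) (fromℕ< m<d)
          (subst₂ _≤_ (sym (Fin.toℕ-fromℕ< l<d)) (sym (Fin.toℕ-fromℕ< m<d)) l≤m)
    ... | no  l≮d | yes m<d = contradiction (ℕ.≤-<-trans l≤m m<d) l≮d
    ... | _       | no  _   = λ k s eq → case trans (sym (Vec.lookup-replicate k nothing)) eq of λ ()

    cover : ∀ i → ∃ λ k → (∃ λ s → lookup (G (toℕ i)) k ≡ just s) × G (suc (toℕ i)) ≡ G (toℕ i) [ k ]≔ nothing
    cover i = ⊆-cover {F = G (toℕ i)} {G (suc (toℕ i))} (G-⊆ (ℕ.n≤1+n _) (Fin.toℕ<n i))
      (trans (dim-G (Fin.toℕ<n i)) (cong suc (sym (dim-G (ℕ.<⇒≤ (Fin.toℕ<n i))))))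

    dir : Fin (suc n) → Fin (suc n)
    dir i = proj₁ (cover i)

    G-suc : ∀ {m} (m<d : m < suc n) → G (suc m) ≡ G m [ dir (fromℕ< m<d) ]≔ nothing
    G-suc m<d = subst (λ m → G (suc m) ≡ G m [ dir (fromℕ< m<d) ]≔ nothing) (Fin.toℕ-fromℕ< m<d)
      (proj₂ (proj₂ (cover (fromℕ< m<d))))

    G-zero : ∃ λ v → G 0 ≡ map just v
    G-zero = vertex (G 0) (dim-G z≤n)

    -- Nothing is free in `G 0`, so a coordinate free in `G m` was released on the way. At m = d
    -- this reaches every coordinate.
    dir-surjective : ∀ m → m ≤ suc n → ∀ k → lookup (G m) k ≡ nothing → ∃ λ i → dir i ≡ k
    dir-surjective zero    _   k eq = case trans (sym eq)
      (trans (cong (λ F → lookup F k) (proj₂ G-zero)) (Vec.lookup-map k just (proj₁ G-zero))) of λ ()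
    dir-surjective (suc m) m<d k eq with k Fin.≟ dir (fromℕ< m<d)
    ... | yes k≡ = fromℕ< m<d , sym k≡
    ... | no  k≢ = dir-surjective m (ℕ.<⇒≤ m<d) k (trans (sym (Vec.lookup∘update′ k≢ (G m) nothing))
      (trans (cong (λ F → lookup F k) (sym (G-suc m<d))) eq))

    G-full : ∀ k → lookup (G (suc n)) k ≡ nothing
    G-full k with (suc n) ℕ.<? (suc n)
    ... | yes d<d = contradiction d<d (ℕ.<-irrefl refl)
    ... | no  _   = Vec.lookup-replicate k nothing

    dir-≢ : ∀ {i j} → toℕ i < toℕ j → dir i ≢ dir j
    dir-≢ {i} {j} i<j eq with proj₁ (proj₂ (cover j))
    ... | s , fixed = case trans (sym fixed) (⊆⇒≲ {F = G (suc (toℕ i))} {G (toℕ j)}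
      (G-⊆ i<j (ℕ.<⇒≤ (Fin.toℕ<n j))) (dir j)
      (trans (cong₂ lookup (proj₂ (proj₂ (cover i))) (sym eq)) (lookup-free (G (toℕ i)) (dir i)))) of λ ()

    dir-injective : ∀ {i j} → dir i ≡ dir j → i ≡ j
    dir-injective {i} {j} eq with Fin.<-cmp i j
    ... | tri< i<j _ _ = contradiction eq (dir-≢ i<j)
    ... | tri≈ _ i≡j _ = i≡j
    ... | tri> _ _ j<i = contradiction (sym eq) (dir-≢ j<i)

    dir⁻¹ : ∀ k → ∃ λ i → dir i ≡ k
    dir⁻¹ k = dir-surjective (suc n) ℕ.≤-refl k (G-full k)

  codeOf : Code (suc n)
  codeOf = code (proj₁ G-zero) (permutation dir (proj₁ ∘ dir⁻¹) (proj₂ ∘ dir⁻¹)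
    (λ i → dir-injective (proj₂ (dir⁻¹ (dir i)))))

  private
    face-codeOf : ∀ m → m ≤ suc n → face codeOf m ≡ G m
    face-codeOf zero    _   = sym (proj₂ G-zero)
    face-codeOf (suc m) m<d = trans
      (cong₂ (λ F k → F [ k ]≔ nothing) (face-codeOf m (ℕ.<⇒≤ m<d))
        (cong dir (trans (cong (_mod (suc n)) (sym (Fin.toℕ-fromℕ< m<d))) (toℕ-mod-Fin (fromℕ< m<d)))))
      (sym (G-suc m<d))

  flagOf-codeOf : f ≈ᶠ flagOf codeOf
  flagOf-codeOf i = ≈-sym (≈-trans
    (inj₁ (trans (face-codeOf (toℕ i) (ℕ.<⇒≤ (Fin.toℕ<n i))) (G-toℕ i)))
    (proj₁ (proj₂ (lift i))))

-- Orbits of codes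

_≅?_ : (c c′ : Code d) → Dec (c ≅ c′)
c ≅? c′ = map′ (λ (p , q) → p , q) (λ (p , q) → p , q)
  ((≡-dec (sgn c) (sgn c′) ⊎-dec ≡-dec (sgn c) (map flip (sgn c′)))
    ×-dec Fin.all? λ i → (perm c ⟨$⟩ʳ i) Fin.≟ (perm c′ ⟨$⟩ʳ i))
  where ≡-dec = Vec.≡-dec Sign._≟_

module _ {n : ℕ} where

  shift^-% : ∀ m (c : Code (suc n)) → shift^ m c ≅ shift^ (m % suc n) c
  shift^-% m c = subst (_≅ shift^ (m % suc n) c)
    (trans (sym (shift^-+ (m % suc n) (m / suc n * suc n) c)) (cong (λ l → shift^ l c) (sym (m≡m%n+[m/n]*n m (suc n)))))
    (shift^-cong (m % suc n) (shift^-periods (m / suc n) c))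

  shift^-mod-cong : ∀ {l m} (c : Code (suc n)) → l % suc n ≡ m % suc n → shift^ l c ≅ shift^ m c
  shift^-mod-cong {l} {m} c eq = ≅-trans (shift^-% l c)
    (≅-trans (subst (λ r → shift^ (l % suc n) c ≅ shift^ r c) eq ≅-refl) (≅-sym (shift^-% m c)))

  -- The leading axes alone distinguish the d members of an orbit.
  shift^-injective : ∀ {l m} (c : Code (suc n)) → shift^ l c ≅ shift^ m c → l % suc n ≡ m % suc n
  shift^-injective {l} {m} c (_ , q) = axis-injective c {l} {m}
    (trans (cong (axis c) (sym (ℕ.+-identityʳ l))) (trans (sym (axis-shift^ l c 0))
      (trans (q (0 mod suc n)) (trans (axis-shift^ m c 0) (cong (axis c) (ℕ.+-identityʳ m))))))

  Orbit : Code (suc n) → Code (suc n) → Set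
  Orbit c c′ = ∃ λ m → shift^ m c ≅ c′

  -- By periodicity the exponents below d suffice. Decidability lets the intersection vector tell
  -- the partners from the zigzags that are not met.
  orbit? : ∀ c c′ → Dec (Orbit c c′)
  orbit? c c′ = map′
    (λ (i , p) → toℕ i , p)
    (λ (m , p) → m mod suc n , ≅-trans (subst (λ l → shift^ l c ≅ shift^ m c) (sym (toℕ-mod m)) (≅-sym (shift^-% m c))) p)
    (Fin.any? λ i → shift^ (toℕ i) c ≅? c′)

  orbit-respʳ : ∀ {c x y : Code (suc n)} → x ≅ y → Orbit c x → Orbit c y
  orbit-respʳ x≅y (m , p) = m , ≅-trans p x≅y

  orbit-trans : ∀ {x y z : Code (suc n)} → Orbit x y → Orbit y z → Orbit x z
  orbit-trans {x} {z = z} (l , p) (m , q) = m + l ,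
    subst (_≅ z) (sym (shift^-+ m l x)) (≅-trans (shift^-cong m p) q)

  orbit-sym : ∀ {x y : Code (suc n)} → Orbit x y → Orbit y x
  -- With d = n + 1, the exponents n * m and m add up to m full periods.
  orbit-sym {x} {y} (m , p) = n * m , ≅-trans (shift^-cong (n * m) (≅-sym p))
    (subst (_≅ x) (trans (cong (λ l → shift^ l x) (trans (ℕ.*-comm m (suc n)) (ℕ.+-comm m (n * m))))
      (shift^-+ (n * m) m x)) (shift^-periods m x))

  -- An orbit has one member per leading axis. This reduces a question about orbits to a comparison
  -- of two codes.
  orbit-axis₀ : ∀ {c x : Code (suc n)} → Orbit c x → axis c 0 ≡ axis x 0 → c ≅ x
  orbit-axis₀ {c} {x} (m , p) eq = ≅-trans
    (shift^-mod-cong {0} {m} c (axis-injective c {0} {m} (trans eq (trans (sym (perms p (0 mod suc n)))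
      (trans (axis-shift^ m c 0) (cong (axis c) (ℕ.+-identityʳ m))))))) p

  orbit-op-shift^ : ∀ m {c} {x : Code (suc n)} → Orbit c (op (shift^ m x)) → Orbit c (op x)
  orbit-op-shift^ m {x = x} o = orbit-trans o (m , shift^-op-shift^ m x)

  -- The cyclic successor of a coordinate is constant along an orbit and inverted by op.
  Follows : Code (suc n) → Fin (suc n) → Fin (suc n) → Set
  Follows c k l = ∃ λ i → perm c ⟨$⟩ʳ i ≡ k × perm c ⟨$⟩ʳ next i ≡ l

  Follows-functional : ∀ c {k l l′} → Follows c k l → Follows c k l′ → l ≡ l′
  Follows-functional c (i , refl , refl) (j , eq , refl) =
    cong (λ i → perm c ⟨$⟩ʳ next i)
      (trans (sym (Perm.inverseˡ (perm c))) (trans (cong (perm c ⟨$⟩ˡ_) (sym eq)) (Perm.inverseˡ (perm c))))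

  Follows-shift^ : ∀ m c {k l} → Follows (shift^ m c) k l → Follows c k l
  Follows-shift^ zero    c fol = fol
  Follows-shift^ (suc m) c (i , p , q) = Follows-shift^ m c (next i , p , q)

  Follows-orbit : ∀ {c x k l} → Orbit c x → Follows x k l → Follows c k l
  Follows-orbit {c} (m , p) (i , q , r) = Follows-shift^ m c (i , trans (perms p i) q , trans (perms p (next i)) r)

perm-injective : ∀ (c : Code d) {i j} → perm c ⟨$⟩ʳ i ≡ perm c ⟨$⟩ʳ j → i ≡ j
perm-injective c eq = trans (sym (Perm.inverseˡ (perm c))) (trans (cong (perm c ⟨$⟩ˡ_) eq) (Perm.inverseˡ (perm c)))

-- Zigzags

module _ {n : ℕ} where

  IsReverse⇒≅ : ∀ {f g : Flag (2+ n)} {x y : Code (2+ n)} → f ≈ᶠ flagOf x → g ≈ᶠ flagOf y → IsReverse f g → y ≅ op (shift^ (suc n) x)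
  IsReverse⇒≅ {f} {g} {x} {y} f≈x g≈y rev = flagOf-injective
    (IsReverse-unique {f = flagOf x} {flagOf x} {flagOf y} {flagOf (op (shift^ (suc n) x))} (≈ᶠ-refl {f = flagOf x})
      (IsReverse-resp {f = f} {flagOf x} {g} {flagOf y} f≈x g≈y rev) (IsReverse-flagOf x))

  record HasCode (Z : Zigzag (2+ n)) (c : Code (2+ n)) : Set where
    field
      len≡ : len Z ≡ 2+ n
      at≈  : ∀ m → at Z m ≈ᶠ flagOf (shift^ m c)

  open HasCode public

  at-toℕ : ∀ (Z : Zigzag (2+ n)) j → at Z (toℕ j) ≡ flag Z j
  at-toℕ Z j = cong (flag Z) (toℕ-mod-Fin {{Zigzag.nonEmpty Z}} j)

  T-at : ∀ (Z : Zigzag (2+ n)) m → T (at Z m) (at Z (suc m))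
  T-at Z m = subst (λ j → T (at Z m) (flag Z j)) (mod-cong {l = suc (toℕ (m mod len Z))} {suc m}
      (trans (cong (λ r → suc r % len Z) (toℕ-mod m)) (suc-% m)))
    (Zigzag.step Z (m mod len Z))
    where instance _ = Zigzag.nonEmpty Z

  at-injective : ∀ (Z : Zigzag (2+ n)) {l m} → at Z l ≈ᶠ at Z m → _%_ l (len Z) {{Zigzag.nonEmpty Z}} ≡ _%_ m (len Z) {{Zigzag.nonEmpty Z}}
  at-injective Z {l} {m} eq = mod-injective {l = l} {m} (Zigzag.distinct Z eq)
    where instance _ = Zigzag.nonEmpty Z

  codeOfᶻ : Zigzag (2+ n) → Code (2+ n)
  codeOfᶻ Z = codeOf (at Z 0)

  -- Uniqueness of T makes the flags of `Z` follow the shifts of the first code. These return after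
  -- d steps while the flags of `Z` are distinct, so the length divides d; and `Z` closes up after
  -- its length while d is the least period of the code, so d divides the length.
  hasCode : ∀ Z → HasCode Z (codeOfᶻ Z)
  hasCode Z = record { len≡ = ∣-antisym len∣d d∣len ; at≈ = at-shift^ }
    where
    instance _ = Zigzag.nonEmpty Z
    c = codeOfᶻ Z
    at-shift^ : ∀ m → at Z m ≈ᶠ flagOf (shift^ m c)
    at-shift^ zero    = flagOf-codeOf (at Z 0)
    at-shift^ (suc m) = T-unique {f = at Z m} {flagOf (shift^ m c)} {at Z (suc m)} {flagOf (shift^ (suc m) c)}
      (at-shift^ m) (T-at Z m) (T-flagOf (shift^ m c))
    len∣d = m%n≡0⇒n∣m (2+ n) (len Z) (trans (at-injective Z {2+ n} {0}
      (≈ᶠ-trans {f = at Z (2+ n)} {flagOf (shift^ (2+ n) c)} {at Z 0} (at-shift^ (2+ n))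
        (≈ᶠ-trans {f = flagOf (shift^ (2+ n) c)} {flagOf c} {at Z 0} (flagOf-cong (shift^-period c))
          (≈ᶠ-sym {f = at Z 0} {flagOf c} (at-shift^ 0))))) (0%n (len Z)))
      where
      0%n : ∀ l .{{_ : NonZero l}} → 0 % l ≡ 0
      0%n (suc l) = refl
    at-len : at Z (len Z) ≡ at Z 0
    at-len = cong (flag Z) (mod-cong {l = len Z} {0} (len%len (len Z)))
      where
      len%len : ∀ l .{{_ : NonZero l}} → l % l ≡ 0 % l
      len%len (suc l) = n%n≡0 (suc l)
    d∣len = m%n≡0⇒n∣m (len Z) (2+ n) (shift^-injective {l = len Z} {0} c (flagOf-injective
      (≈ᶠ-trans {f = flagOf (shift^ (len Z) c)} {at Z (len Z)} {flagOf c}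
        (≈ᶠ-sym {f = at Z (len Z)} {flagOf (shift^ (len Z) c)} (at-shift^ (len Z)))
        (subst (_≈ᶠ flagOf c) (sym at-len) (at-shift^ 0)))))

  zigzagOf : Code (2+ n) → Zigzag (2+ n)
  zigzagOf c = record
    { len      = 2+ n
    ; flag     = λ j → flagOf (shift^ (toℕ j) c)
    ; step     = λ j → σ-upTo-resp (2+ n) {flagOf (shift^ (toℕ j) c)} {flagOf (shift^ (toℕ j) c)} {flagOf (shift^ (suc (toℕ j)) c)}
        {flagOf (shift^ (toℕ (suc (toℕ j) mod 2+ n)) c)} (≈ᶠ-refl {f = flagOf (shift^ (toℕ j) c)})
        (flagOf-cong (shift^-toℕ-mod (suc (toℕ j)))) (T-flagOf (shift^ (toℕ j) c))
    ; distinct = λ {i} {j} eq → Fin.toℕ-injective (trans (sym (m<n⇒m%n≡m (Fin.toℕ<n i)))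
        (trans (shift^-injective {l = toℕ i} {toℕ j} c (flagOf-injective eq)) (m<n⇒m%n≡m (Fin.toℕ<n j))))
    }
    where
    shift^-toℕ-mod : ∀ m → shift^ m c ≅ shift^ (toℕ (m mod 2+ n)) c
    shift^-toℕ-mod m = subst (λ l → shift^ m c ≅ shift^ l c) (sym (toℕ-mod m)) (shift^-% m c)

  zigzagOf-hasCode : ∀ c → HasCode (zigzagOf c) c
  zigzagOf-hasCode c = record
    { len≡ = refl
    ; at≈  = λ m → flagOf-cong (subst (λ l → shift^ l c ≅ shift^ m c) (sym (toℕ-mod m)) (≅-sym (shift^-% m c)))
    }

  module _ {Z : Zigzag (2+ n)} {c : Code (2+ n)} (hZ : HasCode Z c) where

    flag≈ : ∀ j → flag Z j ≈ᶠ flagOf (shift^ (toℕ j) c)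
    flag≈ j = subst (_≈ᶠ flagOf (shift^ (toℕ j) c)) (at-toℕ Z j) (at≈ hZ (toℕ j))

    ∈ᶻ⇒orbit : ∀ {g : Flag (2+ n)} {x : Code (2+ n)} → g ≈ᶠ flagOf x → g ∈ᶻ Z → Orbit c x
    ∈ᶻ⇒orbit {g} {x} g≈x (j , g≈) = toℕ j , flagOf-injective
      (≈ᶠ-trans {f = flagOf (shift^ (toℕ j) c)} {flag Z j} {flagOf x}
        (≈ᶠ-sym {f = flag Z j} {flagOf (shift^ (toℕ j) c)} (flag≈ j))
        (≈ᶠ-trans {f = flag Z j} {g} {flagOf x} (≈ᶠ-sym {f = g} {flag Z j} g≈) g≈x))

    orbit⇒∈ᶻ : ∀ {x : Code (2+ n)} → Orbit c x → flagOf x ∈ᶻ Z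
    orbit⇒∈ᶻ {x} (m , p) = _mod_ m (len Z) {{Zigzag.nonEmpty Z}} ,
      ≈ᶠ-sym {f = at Z m} {flagOf x} (≈ᶠ-trans {f = at Z m} {flagOf (shift^ m c)} {flagOf x} (at≈ hZ m) (flagOf-cong p))

    ∈ᵗ⇒orbit : ∀ {g : Flag (2+ n)} {x : Code (2+ n)} → g ≈ᶠ flagOf x → g ∈ᵗ Z → Orbit c (op x)
    ∈ᵗ⇒orbit {g} {x} g≈x (j , rev) = suc n + toℕ j , subst (_≅ op x) (sym (shift^-+ (suc n) (toℕ j) c))
      (≅-trans (≅-sym (op-involutive (shift^ (suc n) (shift^ (toℕ j) c)))) (op-cong (≅-sym
        (IsReverse⇒≅ {flag Z j} {g} {shift^ (toℕ j) c} {x} (flag≈ j) g≈x rev))))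

  module _ {Z W : Zigzag (2+ n)} {c c′ : Code (2+ n)} (hZ : HasCode Z c) (hW : HasCode W c′) where

    private
      instance
        nonZeroZ = Zigzag.nonEmpty Z

    at-0 : Fin (len Z)
    at-0 = 0 mod len Z

    ∼⇒orbit : Z ∼ W → Orbit c′ c ⊎ Orbit c′ (op c)
    ∼⇒orbit (inj₁ (_ , k , p)) = inj₁ (k + toℕ at-0 , flagOf-injective
      (≈ᶠ-trans {f = flagOf (shift^ (k + toℕ at-0) c′)} {at W (k + toℕ at-0)} {flagOf c}
        (≈ᶠ-sym {f = at W (k + toℕ at-0)} {flagOf (shift^ (k + toℕ at-0) c′)} (at≈ hW _))
        (≈ᶠ-trans {f = at W (k + toℕ at-0)} {at Z 0} {flagOf c} (p at-0) (at≈ hZ 0))))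
    ∼⇒orbit (inj₂ (_ , k , p)) = inj₂ (orbit-op-shift^ (suc n) (k + toℕ (opposite at-0) ,
      IsReverse⇒≅ {at Z 0} {at W (k + toℕ (opposite at-0))} {c} {shift^ (k + toℕ (opposite at-0)) c′}
        (at≈ hZ 0) (at≈ hW _) (p at-0)))

    orbit⇒∼ : Orbit c′ c ⊎ Orbit c′ (op c) → Z ∼ W
    orbit⇒∼ (inj₁ (m , p)) = inj₁ (trans (len≡ hW) (sym (len≡ hZ)) , m , λ j →
      ≈ᶠ-trans {f = at W (m + toℕ j)} {flagOf (shift^ (m + toℕ j) c′)} {flag Z j} (at≈ hW _)
        (≈ᶠ-trans {f = flagOf (shift^ (m + toℕ j) c′)} {flagOf (shift^ (toℕ j) c)} {flag Z j}
          (flagOf-cong (subst (_≅ shift^ (toℕ j) c) (sym (trans (cong (λ l → shift^ l c′) (ℕ.+-comm m (toℕ j)))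
              (shift^-+ (toℕ j) m c′)))
            (shift^-cong (toℕ j) p)))
          (≈ᶠ-sym {f = flag Z j} {flagOf (shift^ (toℕ j) c)} (flag≈ hZ j))))
    -- The flag at `j` reverses to `op` after a = d - 1 + j shifts. The offset 2 gives b = 2 + (d -
    -- 1 - j), hence a + b = 2d, two full periods.
    orbit⇒∼ (inj₂ (m , p)) = inj₂ (trans (len≡ hW) (sym (len≡ hZ)) , 2 + m , λ j →
      IsReverse-resp {f = flagOf (shift^ (toℕ j) c)} {flag Z j} {flagOf (op (shift^ (suc n) (shift^ (toℕ j) c)))}
          {at W (2 + m + toℕ (opposite j))}
        (≈ᶠ-sym {f = flag Z j} {flagOf (shift^ (toℕ j) c)} (flag≈ hZ j))
        (≈ᶠ-trans {f = flagOf (op (shift^ (suc n) (shift^ (toℕ j) c)))} {flagOf (shift^ (2 + m + toℕ (opposite j)) c′)}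
            {at W (2 + m + toℕ (opposite j))}
          (flagOf-cong (reversed j))
          (≈ᶠ-sym {f = at W (2 + m + toℕ (opposite j))} {flagOf (shift^ (2 + m + toℕ (opposite j)) c′)} (at≈ hW _)))
        (IsReverse-flagOf (shift^ (toℕ j) c)))
      where
      reversed : ∀ (j : Fin (len Z)) →
        op (shift^ (suc n) (shift^ (toℕ j) c)) ≅ shift^ (2 + m + toℕ (opposite j)) c′
      reversed j = subst₂ (λ x y → op x ≅ y) (shift^-+ (suc n) (toℕ j) c)
          (trans (sym (shift^-+ b m c′)) (cong (λ l → shift^ l c′) (cong (2 +_) (ℕ.+-comm (toℕ (opposite j)) m))))
        (≅-sym (≅-trans (shift^-cong b (≅-trans p (≅-sym (shift^-op-shift^ a c))))
          (subst (_≅ op (shift^ a c)) (trans (cong (λ l → shift^ l (op (shift^ a c))) (sym b+a)) (shift^-+ b a (op (shift^ a c))))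
            (shift^-periods 2 (op (shift^ a c))))))
        where
        a = suc n + toℕ j
        b = 2 + toℕ (opposite j)
        b+a : b + a ≡ 2 * 2+ n
        b+a = begin
          2 + o + (suc n + i)      ≡⟨ cong (2 +_) (trans (ℕ.+-comm o _) (ℕ.+-assoc (suc n) i o)) ⟩
          2 + (suc n + (i + o))    ≡⟨ cong suc (sym (ℕ.+-suc (suc n) (i + o))) ⟩
          (2+ n) + suc (i + o)          ≡⟨ cong ((2+ n) +_) (trans (toℕ-opposite j) (len≡ hZ)) ⟩
          (2+ n) + (2+ n)                    ≡⟨ cong ((2+ n) +_) (sym (ℕ.+-identityʳ (2+ n))) ⟩
          2 * 2+ n                    ∎
          where
          open ≡-Reasoning
          i = toℕ j
          o = toℕ (opposite j)

    module _ (j : Fin (len Z)) where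

      private
        x = shift^ (toℕ j) c
        k = axis c (toℕ j)

      -- Flips commute with shifts, so σ₁ at position `j` leads into the orbit of `c` flipped at its
      -- j-th axis; in one round every coordinate is used once.
      σ₁-code : flipAt (axis x 0) x ≅ shift^ (toℕ j) (flipAt k c)
      σ₁-code = subst (λ l → flipAt l x ≅ shift^ (toℕ j) (flipAt k c))
        (sym (trans (axis-shift^ (toℕ j) c 0) (cong (axis c) (ℕ.+-identityʳ (toℕ j)))))
        (≅-sym (shift^-flipAt (toℕ j) k c))

      σ₁-flag : ∀ {g : Flag (2+ n)} → σ 1 (flag Z j) g → g ≈ᶠ flagOf (shift^ (toℕ j) (flipAt k c))
      σ₁-flag {g} s = ≈ᶠ-trans {f = g} {flagOf (flipAt (axis x 0) x)} {flagOf (shift^ (toℕ j) (flipAt k c))}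
        (σ-unique 1 {flag Z j} {flagOf x} {g} {flagOf (flipAt (axis x 0) x)} (flag≈ hZ j) s (σ₁-flagOf x))
        (flagOf-cong σ₁-code)

      σ₁∈⇒orbit : σ₁∈ (flag Z j) W → Orbit c′ (flipAt k c)
      σ₁∈⇒orbit (g , s , g∈W) = orbit-trans
        (∈ᶻ⇒orbit hW {g} {shift^ (toℕ j) (flipAt k c)} (σ₁-flag {g} s) g∈W)
        (orbit-sym (toℕ j , ≅-refl))

      orbit⇒σ₁∈ : Orbit c′ (flipAt k c) → σ₁∈ (flag Z j) W
      orbit⇒σ₁∈ o = flagOf (flipAt (axis x 0) x) ,
        σ-resp {k = 1} {flagOf x} {flag Z j} {flagOf (flipAt (axis x 0) x)} {flagOf (flipAt (axis x 0) x)}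
          (≈ᶠ-sym {f = flag Z j} {flagOf x} (flag≈ hZ j)) (≈ᶠ-refl {f = flagOf (flipAt (axis x 0) x)}) (σ₁-flagOf x) ,
        orbit⇒∈ᶻ hW (orbit-trans o (toℕ j , ≅-sym σ₁-code))

      σ₁∈ᵗ⇒orbit : σ₁∈ᵗ (flag Z j) W → Orbit c′ (op (flipAt k c))
      σ₁∈ᵗ⇒orbit (g , s , g∈W) = orbit-op-shift^ (toℕ j)
        (∈ᵗ⇒orbit hW {g} {shift^ (toℕ j) (flipAt k c)} (σ₁-flag {g} s) g∈W)

HasCount-none : ∀ {l} {P : Fin l → Set} → (∀ j → ¬ P j) → HasCount P 0
HasCount-none {l} ¬P = ⊥ , ∣⊥∣≡0 l , λ j → mk⇔ (λ j∈⊥ → contradiction j∈⊥ ∉⊥) (λ p → contradiction p (¬P j))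

HasCount-one : ∀ {l} {P : Fin l → Set} i → P i → (∀ j → P j → j ≡ i) → HasCount P 1
HasCount-one {P = P} i Pi unique = ⁅ i ⁆ , ∣⁅x⁆∣≡1 i , λ j →
  mk⇔ (λ j∈ → subst P (sym (x∈⁅y⁆⇒x≡y i j∈)) Pi) (λ p → subst (λ k → j ∈ ⁅ k ⁆) (unique j p) (x∈⁅x⁆ j))

Pointwise-tabulate-replicate : ∀ {A B : Set} {R : A → B → Set} {f : Fin n → A} {y : B} →
  (∀ i → R (f i) y) → Pointwise R (tabulateˡ f) (replicate n y)
Pointwise-tabulate-replicate {zero}  r = []
Pointwise-tabulate-replicate {suc n} r = r zero ∷ Pointwise-tabulate-replicate (r ∘ suc)

-- Intersections

module _ {n : ℕ} where

  -- The coordinate in place 1 is followed by the one in place 2, but in the reversed order by the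
  -- one in place 0, and these differ for d ≥ 3. Only permutations are compared, so the statement
  -- covers codes with different signs, as flips produce them.
  op-orbit-disjoint : ∀ {c x y : Code (suc (2+ n))} → perm x Perm.≈ perm y → Orbit c x → ¬ Orbit c (op y)
  op-orbit-disjoint {c} {x} {y} x≈y o o′ = case perm-injective x same of λ ()
    where
    one : Fin (suc (2+ n))
    one = suc zero
    forward : Follows c (perm x ⟨$⟩ʳ one) (perm x ⟨$⟩ʳ suc (suc zero))
    forward = Follows-orbit o (one , refl , refl)
    backward : Follows c (perm x ⟨$⟩ʳ one) (perm x ⟨$⟩ʳ zero)
    backward = Follows-orbit o′ (opposite one ,
      trans (cong (perm y ⟨$⟩ʳ_) (Fin.opposite-involutive one)) (sym (x≈y one)) ,
      trans (cong (perm y ⟨$⟩ʳ_) (trans (cong opposite (next-inject₁ (opposite {2+ n} zero))) (Fin.opposite-involutive {n = suc (2+ n)} zero))) (sym (x≈y zero)))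
    same : perm x ⟨$⟩ʳ suc (suc zero) ≡ perm x ⟨$⟩ʳ zero
    same = Follows-functional c forward backward

  flipAt-≇ : ∀ k (c : Code (suc (2+ n))) → ¬ (flipAt k c ≅ c)
  flipAt-≇ k c (p , _) = flips-one (sgn c) k p

  flipAt-injective : ∀ {k l} (c : Code (suc (2+ n))) → flipAt k c ≅ flipAt l c → k ≡ l
  flipAt-injective {k} {l} c (p , _) with k Fin.≟ l
  ... | yes k≡l = k≡l
  ... | no  k≢l = contradiction p (flips-mixed k m
          (trans (Vec.lookup∘updateAt k (sgn c)) (cong flip (sym (Vec.lookup∘updateAt′ k l k≢l (sgn c)))))
          (trans (Vec.lookup∘updateAt′ m k m≢k (sgn c)) (sym (Vec.lookup∘updateAt′ m l m≢l (sgn c)))))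
    where
    -- A third coordinate, untouched by both flips, excludes that they differ by a negation.
    m : Fin (suc (2+ n))
    m = punchIn k (punchIn (punchOut k≢l) zero)
    m≢k : m ≢ k
    m≢k = Fin.punchInᵢ≢i k _
    m≢l : m ≢ l
    m≢l eq = Fin.punchInᵢ≢i (punchOut k≢l) zero
      (Fin.punchIn-injective k _ _ (trans eq (sym (Fin.punchIn-punchOut k≢l))))

  flipAt-orbit : ∀ {c : Code (suc (2+ n))} {k l} → Orbit (flipAt k c) (flipAt l c) → k ≡ l
  flipAt-orbit {c} o = flipAt-injective c (orbit-axis₀ o refl)

  module _ {Z : Zigzag (suc (2+ n))} {c : Code (suc (2+ n))} (hZ : HasCode Z c) where

    noSelfIntersections : NoSelfIntersections Z
    noSelfIntersections j =
      (λ s → flipAt-≇ _ c (≅-sym (orbit-axis₀ (σ₁∈⇒orbit hZ hZ j s) refl))) ,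
      (λ s → op-orbit-disjoint {x = c} {flipAt (axis c (toℕ j)) c} (λ _ → refl) (0 , ≅-refl) (σ₁∈ᵗ⇒orbit hZ hZ j s))

    partner : Fin (suc (2+ n)) → Zigzag (suc (2+ n))
    partner k = zigzagOf (flipAt k c)

    partner-signature : ∀ k → NormalizedSignature Z (partner k) (0 , 1)
    -- With this orientation of the partner the signature is (1 , 0): the meeting is of the first
    -- type, at the position where `k` is the leading axis. Normalizing swaps the entries.
    partner-signature k = z≤n , inj₂
      ( HasCount-one i (orbit⇒σ₁∈ hZ hW i (0 , at-i)) (λ j s → unique j (flipAt-orbit (σ₁∈⇒orbit hZ hW j s)))
      , HasCount-none λ j s → op-orbit-disjoint {x = flipAt k c} {flipAt (axis c (toℕ j)) c}
          (λ _ → refl) (0 , ≅-refl) (σ₁∈ᵗ⇒orbit hZ hW j s))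
      where
      hW = zigzagOf-hasCode (flipAt k c)
      rank<len : rank c k < len Z
      rank<len = subst (rank c k <_) (sym (len≡ hZ)) (Fin.toℕ<n (perm c ⟨$⟩ˡ k))
      i : Fin (len Z)
      i = fromℕ< rank<len
      at-i : flipAt k c ≅ flipAt (axis c (toℕ i)) c
      at-i = subst (λ l → flipAt k c ≅ flipAt l c)
        (sym (trans (cong (axis c) (Fin.toℕ-fromℕ< rank<len)) (axis-rank c k))) ≅-refl
      unique : ∀ j → k ≡ axis c (toℕ j) → j ≡ i
      unique j eq = Fin.toℕ-injective (trans (sym (rank-axis c (subst (toℕ j <_) (len≡ hZ) (Fin.toℕ<n j))))
        (trans (cong (rank c) (sym eq)) (sym (Fin.toℕ-fromℕ< rank<len))))

    partner-≁ : ∀ {k l} → k ≢ l → ¬ (partner k ∼ partner l)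
    partner-≁ {k} {l} k≢l p with ∼⇒orbit (zigzagOf-hasCode (flipAt k c)) (zigzagOf-hasCode (flipAt l c)) p
    ... | inj₁ o = k≢l (sym (flipAt-orbit o))
    ... | inj₂ o = op-orbit-disjoint {x = flipAt l c} {flipAt k c} (λ _ → refl) (0 , ≅-refl) o

    self-≁-partner : ∀ k → ¬ (Z ∼ partner k)
    self-≁-partner k p with ∼⇒orbit hZ (zigzagOf-hasCode (flipAt k c)) p
    ... | inj₁ o = flipAt-≇ k c (orbit-axis₀ o refl)
    ... | inj₂ o = op-orbit-disjoint {x = flipAt k c} {c} (λ _ → refl) (0 , ≅-refl) o

    -- A meeting of either type puts some flip of `c`, or its `op`, into the orbit of `c′`, which
    -- makes `W` equal to that partner. A search through the finitely many flips decides.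
    other-signature : ∀ {W c′} → HasCode W c′ → (∃ λ k → partner k ∼ W) ⊎ NormalizedSignature Z W (0 , 0)
    other-signature {W} {c′} hW = case Fin.any? meets? of λ
      { (yes (k , o)) → inj₁ (k , orbit⇒∼ (zigzagOf-hasCode (flipAt k c)) hW o)
      ; (no ¬o)       → inj₂ (z≤n , inj₁
          ( HasCount-none (λ j s → ¬o (axis c (toℕ j) , inj₁ (σ₁∈⇒orbit hZ hW j s)))
          , HasCount-none (λ j s → ¬o (axis c (toℕ j) , inj₂ (σ₁∈ᵗ⇒orbit hZ hW j s)))))
      }
      where
      meets? : ∀ k → Dec (Orbit c′ (flipAt k c) ⊎ Orbit c′ (op (flipAt k c)))
      meets? k = orbit? c′ (flipAt k c) ⊎-dec orbit? c′ (op (flipAt k c))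

    intersectionVector : IntersectionVector Z (replicate (suc (2+ n)) (0 , 1))
    intersectionVector = record
      { partners   = tabulateˡ partner
      ; pairwise   = AllPairs.tabulate⁺ {R = λ V W → ¬ (V ∼ W)} {f = partner} partner-≁
      ; other      = All.tabulate⁺ {P = λ W → ¬ (Z ∼ W)} {f = partner} self-≁-partner
      ; signatures = Pointwise-tabulate-replicate {R = NormalizedSignature Z} {f = partner} partner-signature
      ; nonzero    = All.replicate⁺ (suc (2+ n)) λ ()
      ; remaining  = λ W _ → Sum.map₁ (λ (k , p) → Any.tabulate⁺ {P = _∼ W} {f = partner} k p) (other-signature (hasCode W))
      }

-- Counting

remQuot-injective : ∀ {m} k {i j : Fin (m * k)} → remQuot {m} k i ≡ remQuot k j → i ≡ j
remQuot-injective {m} k {i} {j} eq = trans (sym (Fin.combine-remQuot {m} k i))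
  (trans (cong (λ (a , b) → combine a b) eq) (Fin.combine-remQuot {m} k j))

signOf : Fin 2 → Sign
signOf zero       = Sign.+
signOf (suc zero) = Sign.-

signOf-injective : ∀ {i j} → signOf i ≡ signOf j → i ≡ j
signOf-injective {zero}     {zero}     _ = refl
signOf-injective {zero}     {suc zero} ()
signOf-injective {suc zero} {zero}     ()
signOf-injective {suc zero} {suc zero} _ = refl

signOf⁻¹ : ∀ s → ∃ λ i → signOf i ≡ s
signOf⁻¹ Sign.+ = zero , refl
signOf⁻¹ Sign.- = suc zero , refl

signsOf : ∀ n → Fin (2 ^ n) → Vec Sign n
signsOf n a = tabulate (signOf ∘ finToFun a)

funToFin-cong : ∀ {m n} {f g : Fin m → Fin n} → (∀ i → f i ≡ g i) → funToFin f ≡ funToFin g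
funToFin-cong {zero}  eq = refl
funToFin-cong {suc m} eq = cong₂ combine (eq zero) (funToFin-cong (eq ∘ suc))

signsOf-injective : ∀ n {a b} → signsOf n a ≡ signsOf n b → a ≡ b
signsOf-injective n {a} {b} eq = begin
  a                             ≡⟨ Fin.funToFin-finToFin {n} {2} a ⟨
  funToFin (finToFun {2} {n} a) ≡⟨ funToFin-cong (λ i → signOf-injective (pointwise i)) ⟩
  funToFin (finToFun {2} {n} b) ≡⟨ Fin.funToFin-finToFin {n} {2} b ⟩
  b                             ∎
  where
  open ≡-Reasoning
  pointwise : ∀ i → signOf (finToFun {2} {n} a i) ≡ signOf (finToFun {2} {n} b i)
  pointwise i = trans (sym (Vec.lookup∘tabulate (signOf ∘ finToFun {2} {n} a) i))
    (trans (cong (λ v → lookup v i) eq) (Vec.lookup∘tabulate (signOf ∘ finToFun {2} {n} b) i))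

signsOf⁻¹ : ∀ n v → ∃ λ a → signsOf n a ≡ v
signsOf⁻¹ n v = funToFin digits , trans
  (Vec.tabulate-cong λ i → trans (cong signOf (Fin.finToFun-funToFin digits i)) (proj₂ (signOf⁻¹ (lookup v i))))
  (Vec.tabulate∘lookup v)
  where
  digits : Fin n → Fin 2
  digits i = proj₁ (signOf⁻¹ (lookup v i))

-- Follows the recursion of the factorial: the image of `zero`, then a permutation of the remaining
-- places.
permOf : ∀ n → Fin (n !) → Permutation′ n
permOf zero    _ = Perm.id
permOf (suc n) i = insert zero (proj₁ (remQuot {suc n} (n !) i)) (permOf n (proj₂ (remQuot {suc n} (n !) i)))

permOf-injective : ∀ n {i j} → permOf n i Perm.≈ permOf n j → i ≡ j
permOf-injective zero    {zero} {zero} _ = refl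
permOf-injective (suc n) {i} {j} eq = remQuot-injective {suc n} (n !) (cong₂ _,_ (eq zero)
  (permOf-injective n λ k → Fin.punchIn-injective a _ _ (begin
    punchIn a (π ⟨$⟩ʳ k)              ≡⟨ Perm.insert-punchIn zero a π k ⟨
    insert zero a π ⟨$⟩ʳ suc k        ≡⟨ eq (suc k) ⟩
    insert zero b ρ ⟨$⟩ʳ suc k        ≡⟨ Perm.insert-punchIn zero b ρ k ⟩
    punchIn b (ρ ⟨$⟩ʳ k)              ≡⟨ cong (λ c → punchIn c (ρ ⟨$⟩ʳ k)) (eq zero) ⟨
    punchIn a (ρ ⟨$⟩ʳ k)              ∎)))
  where
  open ≡-Reasoning
  a = proj₁ (remQuot {suc n} (n !) i)
  b = proj₁ (remQuot {suc n} (n !) j)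
  π = permOf n (proj₂ (remQuot {suc n} (n !) i))
  ρ = permOf n (proj₂ (remQuot {suc n} (n !) j))

permOf⁻¹ : ∀ n (π : Permutation′ n) → ∃ λ i → permOf n i Perm.≈ π
permOf⁻¹ zero    π = zero , λ ()
permOf⁻¹ (suc n) π with permOf⁻¹ n (remove zero π)
... | j , eq = combine a j , λ k → trans (cong (λ (b , l) → insert zero b (permOf n l) ⟨$⟩ʳ k) (Fin.remQuot-combine a j))
      (trans (insert-cong k) (Perm.insert-remove zero π k))
  where
  a = π ⟨$⟩ʳ zero
  insert-cong : insert zero a (permOf n j) Perm.≈ insert zero a (remove zero π)
  insert-cong zero    = refl
  insert-cong (suc k) = cong (punchIn a) (eq k)

module _ {n : ℕ} where

  -- Shifting brings the coordinate  zero  to the front; then c and op (shift c), which lies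
  -- on the reversed zigzag, differ in the sign of  zero , and c and its negative in all signs.
  normalCode : Vec Sign (suc n) → Permutation′ (2+ n) → Code (suc (2+ n))
  normalCode v π = code (Sign.+ ∷ Sign.+ ∷ v) (lift₀ π)

  normalCode-injective : ∀ {v w π ρ} → normalCode v π ≅ normalCode w ρ → v ≡ w × π Perm.≈ ρ
  normalCode-injective (inj₁ refl , q) = refl , λ i → Fin.suc-injective (q (suc i))

  -- The shift flips the leading coordinate `zero`, so the right-hand code has signs - and + at the
  -- first two coordinates, where the left-hand one has + twice.
  normalCode-op : ∀ {v w π ρ} → ¬ (normalCode v π ≅ op (shift (normalCode w ρ)))
  normalCode-op (p , _) = flips-mixed zero (suc zero) refl refl p

  normalise : ∀ (c : Code (suc (2+ n))) → axis c 0 ≡ zero → lookup (sgn c) zero ≡ lookup (sgn c) (suc zero) →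
              ∃ λ v → ∃ λ π → normalCode v π ≅ c
  normalise c@(code (Sign.+ ∷ Sign.+ ∷ v) π) eq _ = v , remove zero π , inj₁ refl , Perm.lift₀-remove π eq
  normalise c@(code (Sign.- ∷ Sign.- ∷ v) π) eq _ = map flip v , remove zero π ,
    inj₂ refl , Perm.lift₀-remove π eq

  normalise-reversal : ∀ (x : Code (suc (2+ n))) → axis x 0 ≡ zero →
                       ∃ λ v → ∃ λ π → Orbit x (normalCode v π) ⊎ Orbit x (op (normalCode v π))
  normalise-reversal x eq with lookup (sgn x) zero Sign.≟ lookup (sgn x) (suc zero)
  ... | yes same = let v , π , p = normalise x eq same in v , π , inj₁ (0 , ≅-sym p)
  ... | no  diff = let v , π , p = normalise (op (shift x)) (trans (axis-op x) eq) same in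
                   v , π , inj₂ (1 , ≅-trans (≅-sym (op-involutive (shift x))) (op-cong (≅-sym p)))
    where
    same : lookup (sgn (shift x)) zero ≡ lookup (sgn (shift x)) (suc zero)
    same = subst (λ k → lookup (sgn x [ k ]%= flip) zero ≡ lookup (sgn x [ k ]%= flip) (suc zero)) (sym eq)
      (trans (Vec.lookup∘updateAt zero (sgn x)) (trans (cong flip (≢⇒≡flip diff))
        (trans (Sign.opposite-involutive _) (sym (Vec.lookup∘updateAt′ (suc zero) zero (λ ()) (sgn x))))))

  normalise-orbit : ∀ (c : Code (suc (2+ n))) → ∃ λ v → ∃ λ π → Orbit c (normalCode v π) ⊎ Orbit c (op (normalCode v π))
  normalise-orbit c = let v , π , o = normalise-reversal x axis-x in
    v , π , Sum.map (orbit-trans {x = c} {x} {normalCode v π} c→x) (orbit-trans {x = c} {x} {op (normalCode v π)} c→x) o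
    where
    m = rank c zero
    x = shift^ m c
    c→x : Orbit c x
    c→x = m , ≅-refl
    axis-x : axis x 0 ≡ zero
    axis-x = trans (axis-shift^ m c 0) (trans (cong (axis c) (ℕ.+-identityʳ m)) (axis-rank c zero))

  module _ {N₁ N₂ : ℕ} (signs : Fin N₁ → Vec Sign (suc n)) (permutations : Fin N₂ → Permutation′ (2+ n)) where

    codeAt : Fin N₁ × Fin N₂ → Code (suc (2+ n))
    codeAt (a , b) = normalCode (signs a) (permutations b)

    zigzags : Fin (N₁ * N₂) → Zigzag (suc (2+ n))
    zigzags i = zigzagOf (codeAt (remQuot {N₁} N₂ i))

    module _ (signs-injective : ∀ {a b} → signs a ≡ signs b → a ≡ b)
             (signs⁻¹ : ∀ v → ∃ λ a → signs a ≡ v)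
             (permutations-injective : ∀ {a b} → permutations a Perm.≈ permutations b → a ≡ b)
             (permutations⁻¹ : ∀ π → ∃ λ b → permutations b Perm.≈ π) where

      codeAt-injective : ∀ {x y} → Orbit (codeAt y) (codeAt x) ⊎ Orbit (codeAt y) (op (codeAt x)) → x ≡ y
      codeAt-injective {a , b} {a′ , b′} (inj₁ o) =
        let v≡ , π≈ = normalCode-injective {signs a′} {signs a} {permutations b′} {permutations b}
                        (orbit-axis₀ {c = codeAt (a′ , b′)} {codeAt (a , b)} o refl) in
        sym (cong₂ _,_ (signs-injective v≡) (permutations-injective π≈))
      -- `op (codeAt x)` does not start with `zero`; `op (shift (codeAt x))` in the same orbit does,
      -- which makes the two codes comparable.
      codeAt-injective {x@(a , b)} {y@(a′ , b′)} (inj₂ o) = contradiction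
        (orbit-axis₀ {c = codeAt y} {op (shift (codeAt x))}
          (orbit-trans {x = codeAt y} {op (codeAt x)} {op (shift (codeAt x))} o
            (orbit-sym {x = op (shift (codeAt x))} {op (codeAt x)} (1 , shift-op-shift (codeAt x))))
          (sym (axis-op (codeAt x))))
        (normalCode-op {signs a′} {signs a} {permutations b′} {permutations b})

      codeAt-surjective : ∀ v π → ∃ λ x → normalCode v π ≅ codeAt x
      codeAt-surjective v π with signs⁻¹ v | permutations⁻¹ π
      ... | a , refl | b , π≈ = (a , b) , (inj₁ refl , λ i → sym (Perm.lift₀-cong (permutations b) π π≈ i))

      zigzags-injective : ∀ {i j} → zigzags i ∼ zigzags j → i ≡ j
      zigzags-injective {i} {j} p = remQuot-injective {N₁} N₂ (codeAt-injective
        (∼⇒orbit (zigzagOf-hasCode (codeAt (remQuot {N₁} N₂ i))) (zigzagOf-hasCode (codeAt (remQuot {N₁} N₂ j))) p))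

      zigzags-surjective : ∀ {Z c} → HasCode Z c → ∃ λ i → zigzags i ∼ Z
      zigzags-surjective {Z} {c} hZ with normalise-orbit c
      ... | v , π , o with codeAt-surjective v π
      ...   | (a , b) , p = combine a b , subst (λ y → zigzagOf (codeAt y) ∼ Z) (sym (Fin.remQuot-combine {N₁} a b))
        (orbit⇒∼ (zigzagOf-hasCode (codeAt (a , b))) hZ
          (Sum.map (orbit-respʳ {c = c} {normalCode v π} {codeAt (a , b)} p)
            (orbit-respʳ {c = c} {op (normalCode v π)} {op (codeAt (a , b))} (op-cong p)) o))

      zigzags-bijective : Bijective _≡_ _∼_ zigzags
      zigzags-bijective = zigzags-injective ,
        λ Z → let i , p = zigzags-surjective (hasCode Z) in i , λ { refl → p }

-- With d = n + 3: signs at the d - 2 coordinates other than the first two, and an order of the d -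
-- 1 coordinates that follow `zero`.
enumeration : ∀ n → Fin (2 ^ suc n * 2+ n !) → Zigzag (suc (2+ n))
enumeration n = zigzags (signsOf (suc n)) (permOf (2+ n))

enumeration-bijective : ∀ n → Bijective _≡_ _∼_ (enumeration n)
enumeration-bijective n = zigzags-bijective (signsOf (suc n)) (permOf (2+ n))
  (signsOf-injective (suc n)) (signsOf⁻¹ (suc n)) (permOf-injective (2+ n)) (permOf⁻¹ (2+ n))

proposition4p8 : (d : ℕ) → 3 ≤ d →
    (Σ (Fin (2 ^ (d ∸ 2) * (d ∸ 1) !) → Zigzag d) λ zs → Bijective _≡_ _∼_ zs)
    × (∀ (Z : Zigzag d) →
    len Z ≡ d
    × NoSelfIntersections Z
    × IntersectionVector Z (replicate d (0 , 1)))
proposition4p8 (suc (suc (suc n))) (s≤s (s≤s (s≤s z≤n))) =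
  (enumeration n , enumeration-bijective n) ,
  λ Z → len≡ (hasCode Z) , noSelfIntersections (hasCode Z) , intersectionVector (hasCode Z)
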